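{- Let $H$ be a graph with $\chi(H)=r\ge 3$. If $$\delta_\chi(H)\in\left\{\frac{r-3}{r-2},\ \frac{2r-5}{2r-3}\right\},$$ then $\delta_\chi(H)\le\delta_{\mathrm{VC}}(H)$.
   Context: All graphs are finite and simple. A graph is $H$-free if it contains no (not necessarily induced) subgraph isomorphic to $H$; it is maximal $H$-free if it is $H$-free and adding any missing edge creates a copy of $H$. $\delta(G)$ denotes minimum degree and $\chi$ the chromatic number. The chromatic threshold $\delta_\chi(H)$ is the infimum of all $\gamma>0$ for which there is a constant $C=C(\gamma,H)$ such that every $H$-free graph $G$ with $\delta(G)\ge\gamma|V(G)|$ has $\chi(G)\le C$. The VC-dimension $\mathrm{VC}(G)$ of a graph $G$ is the maximum size of a set $S\subseteq V(G)$ such that $\{N_G(v)\cap S: v\in V(G)\}=2^S$. The VC-dimension threshold $\delta_{\mathrm{VC}}(H)$ is the infimum of all $\gamma\ge 0$ for which there exists a constant $C=C(\gamma,H)$ such that every maximal $H$-free graph $G$ with $\delta(G)\ge\gamma|V(G)|$ satisfies $\mathrm{VC}(G)\le C$. -}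

module Defs where

open import Level using (Level; 0ℓ; _⊔_) renaming (suc to lsuc)
open import Data.Bool using (Bool; T; _∨_; _∧_)
open import Data.Bool.Properties using (T-∨; T-∧)
open import Data.Empty using (⊥-elim)
open import Data.Fin using (Fin; _≟_)
open import Data.Fin.Subset using (Subset; _∩_; _⊆_; ∣_∣)
open import Data.Fin.Subset.Properties using (∣p∣≤n)
open import Data.Integer as ℤ using (+_)
import Data.Integer.Properties as ℤ
open import Data.Nat as ℕ using (ℕ; suc; z≤n; s≤s)
import Data.Nat.Properties as ℕ
open import Data.Product using (∃; ∃-syntax; _×_; _,_; proj₁; proj₂)
open import Data.Rational using (ℚ; 0ℚ; 1ℚ; _+_; _*_; _<_; _≤_; *≤*; *<*)
import Data.Rational.Properties as ℚ
open import Data.Rational.Literals using (fromℤ)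
open import Data.Sum using (_⊎_; inj₁; inj₂)
open import Data.Vec using (tabulate)
open import Function using (Equivalence)
open import Function.Definitions using (Injective)
open import Relation.Binary.PropositionalEquality using (_≡_; _≢_; refl; sym; trans; subst)
open import Relation.Nullary using (¬_)
open import Relation.Nullary.Decidable using (⌊_⌋; toWitness)

private
  variable
    a b ℓ : Level

-- A real number x, presented by its upper Dedekind cut { p ∈ ℚ | x < p }.
-- Classically these are exactly the real numbers. Requiring a located
-- two-sided cut instead would make infima of bounded sets partial
-- constructively.
record ℝ ℓ : Set (lsuc ℓ) where
  field
    Upper     : ℚ → Set ℓ
    inhabited : ∃ Upper
    bounded   : ∃[ q ] (∀ {p} → Upper p → q < p)
    upward    : ∀ {p q} → Upper p → p < q → Upper q
    rounded   : ∀ {p} → Upper p → ∃[ q ] (q < p × Upper q)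

open ℝ public

infix 4 _≤ᴿ_ _<ᴿ_ _≈ᴿ_

_≤ᴿ_ : ℝ a → ℝ b → Set (a ⊔ b)
x ≤ᴿ y = ∀ {p} → Upper y p → Upper x p

_≈ᴿ_ : ℝ a → ℝ b → Set (a ⊔ b)
x ≈ᴿ y = x ≤ᴿ y × y ≤ᴿ x

private
  p<p+1 : ∀ p → p < p + 1ℚ
  p<p+1 p = subst (_< p + 1ℚ) (ℚ.+-identityʳ p) (ℚ.+-monoʳ-< p (ℚ.positive⁻¹ 1ℚ))

fromℚ : ℚ → ℝ 0ℓ
fromℚ q = record
  { Upper     = q <_
  ; inhabited = q + 1ℚ , p<p+1 q
  ; bounded   = q , λ q<p → q<p
  ; upward    = ℚ.<-trans
  ; rounded   = λ q<p → let m , q<m , m<p = ℚ.<-dense q<p in m , m<p , q<m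
  }

fromℕ : ℕ → ℚ
fromℕ n = fromℤ (+ n)

_<ᴿ_ : ℝ a → ℝ b → Set (a ⊔ b)
x <ᴿ y = ∃[ q ] (Upper x q × fromℚ q ≤ᴿ y)

infixl 7 _*ⁿ_

_*ⁿ_ : ℝ ℓ → ℕ → ℝ ℓ
x *ⁿ n = record
  { Upper     = λ p → ∃[ q ] (Upper x q × q * fromℕ n < p)
  ; inhabited = let q , xq = inhabited x in q * fromℕ n + 1ℚ , q , xq , p<p+1 (q * fromℕ n)
  ; bounded   = let q , q< = bounded x in
                q * fromℕ n , λ (_ , xr , rn<p) → ℚ.≤-<-trans (ℚ.*-monoʳ-≤-nonNeg (fromℕ n) (ℚ.<⇒≤ (q< xr))) rn<p
  ; upward    = λ (q , xq , qn<p) p<p′ → q , xq , ℚ.<-trans qn<p p<p′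
  ; rounded   = λ (q , xq , qn<p) → let m , qn<m , m<p = ℚ.<-dense qn<p in m , m<p , q , xq , qn<m
  }

inf : (S : ℝ 0ℓ → Set ℓ) → ∃ S → ∃[ q ] (∀ {x} → S x → fromℚ q ≤ᴿ x) → ℝ (lsuc 0ℓ ⊔ ℓ)
inf S (x₀ , Sx₀) (q , q≤) = record
  { Upper     = λ p → ∃[ x ] (S x × Upper x p)
  ; inhabited = let p , x₀p = inhabited x₀ in p , x₀ , Sx₀ , x₀p
  ; bounded   = q , λ (_ , Sx , xp) → q≤ Sx xp
  ; upward    = λ (x , Sx , xp) p<p′ → x , Sx , upward x xp p<p′
  ; rounded   = λ (x , Sx , xp) → let m , m<p , xm = rounded x xp in m , m<p , x , Sx , xm
  }

record Graph : Set where
  field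
    order  : ℕ
    adj    : Fin order → Fin order → Bool
    symm   : ∀ {u v} → T (adj u v) → T (adj v u)
    irrefl : ∀ {v} → ¬ T (adj v v)

  Vertex : Set
  Vertex = Fin order

  Adj : Vertex → Vertex → Set
  Adj u v = T (adj u v)

  N : Vertex → Subset order
  N v = tabulate (adj v)

  degree : Vertex → ℕ
  degree v = ∣ N v ∣

open Graph public

Contains : Graph → Graph → Set
Contains G H = ∃ λ (f : Vertex H → Vertex G) → Injective _≡_ _≡_ f × (∀ {u v} → Adj H u v → Adj G (f u) (f v))

Free : Graph → Graph → Set
Free H G = ¬ Contains G H

addEdge : (G : Graph) (u v : Vertex G) → u ≢ v → Graph
addEdge G u v u≢v = record
  { order  = order G
  ; adj    = λ x y → adj G x y ∨ (new x y ∨ new y x)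
  ; symm   = λ {x} {y} → symm′ x y
  ; irrefl = λ {x} → irrefl′ x
  }
  where
  open Equivalence
  new : Vertex G → Vertex G → Bool
  new x y = ⌊ x ≟ u ⌋ ∧ ⌊ y ≟ v ⌋

  symm′ : ∀ x y → T (adj G x y ∨ (new x y ∨ new y x)) → T (adj G y x ∨ (new y x ∨ new x y))
  symm′ x y e with to (T-∨ {adj G x y}) e
  ... | inj₁ xy = from (T-∨ {adj G y x}) (inj₁ (symm G xy))
  ... | inj₂ e′ with to (T-∨ {new x y}) e′
  ...   | inj₁ xy = from (T-∨ {adj G y x}) (inj₂ (from (T-∨ {new y x}) (inj₂ xy)))
  ...   | inj₂ yx = from (T-∨ {adj G y x}) (inj₂ (from (T-∨ {new y x}) (inj₁ yx)))

  ¬new : ∀ x → ¬ T (new x x)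
  ¬new x e = let p , q = to (T-∧ {⌊ x ≟ u ⌋}) e in
    u≢v (trans (sym (toWitness {a? = x ≟ u} p)) (toWitness {a? = x ≟ v} q))

  irrefl′ : ∀ x → ¬ T (adj G x x ∨ (new x x ∨ new x x))
  irrefl′ x e with to (T-∨ {adj G x x}) e
  ... | inj₁ xx = irrefl G xx
  ... | inj₂ e′ with to (T-∨ {new x x}) e′
  ...   | inj₁ n = ¬new x n
  ...   | inj₂ n = ¬new x n

MaximalFree : Graph → Graph → Set
MaximalFree H G = Free H G × (∀ u v (u≢v : u ≢ v) → ¬ Adj G u v → Contains (addEdge G u v u≢v) H)

Colourable : Graph → ℕ → Set
Colourable G k = ∃ λ (c : Vertex G → Fin k) → ∀ {u v} → Adj G u v → c u ≢ c v

HasChromaticNumber : Graph → ℕ → Set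
HasChromaticNumber G k = Colourable G k × (∀ j → Colourable G j → k ℕ.≤ j)

ChromaticNumber≤ : Graph → ℕ → Set
ChromaticNumber≤ G C = ∃[ k ] (HasChromaticNumber G k × k ℕ.≤ C)

Shattered : (G : Graph) → Subset (order G) → Set
Shattered G S = ∀ A → A ⊆ S → ∃[ v ] (N G v ∩ S ≡ A)

-- VC(G) is a maximum over shattered sets, so VC(G) ≤ C bounds all of them;
-- in the graph without vertices no set is shattered.
VC≤ : Graph → ℕ → Set
VC≤ G C = ∀ S → Shattered G S → ∣ S ∣ ℕ.≤ C

-- δ(G) ≥ γ |V(G)|, where δ(G) is a minimum over the vertices.
MinDegree≥ : Graph → ℝ ℓ → Set ℓ
MinDegree≥ G γ = ∀ v → γ *ⁿ order G ≤ᴿ fromℚ (fromℕ (degree G v))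

ChromaticBounded : Graph → ℝ 0ℓ → Set
ChromaticBounded H γ = fromℚ 0ℚ <ᴿ γ × ∃[ C ] (∀ G → Free H G → MinDegree≥ G γ → ChromaticNumber≤ G C)

VCBounded : Graph → ℝ 0ℓ → Set
VCBounded H γ = fromℚ 0ℚ ≤ᴿ γ × ∃[ C ] (∀ G → MaximalFree H G → MinDegree≥ G γ → VC≤ G C)

private
  2ℚ : ℚ
  2ℚ = fromℕ 2

  0<2 : 0ℚ < 2ℚ
  0<2 = ℚ.positive⁻¹ 2ℚ

  fromℕ-mono : ∀ {m n} → m ℕ.≤ n → fromℕ m ≤ fromℕ n
  fromℕ-mono m≤n = *≤* (ℤ.*-monoʳ-≤-nonNeg (+ 1) (ℤ.+≤+ m≤n))

  degree<2n : ∀ n (d : ℕ) → Fin n → d ℕ.≤ n → fromℕ d < 2ℚ * fromℕ n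
  degree<2n n@(suc _) d _ d≤n = ℚ.≤-<-trans (fromℕ-mono d≤n)
    (subst (_< 2ℚ * fromℕ n) (ℚ.*-identityˡ (fromℕ n))
      (ℚ.*-monoˡ-<-pos (fromℕ n) {1ℚ} {2ℚ} (*<* (ℤ.+<+ (s≤s (s≤s z≤n))))))

  noVertex : ∀ G → MinDegree≥ G (fromℚ 2ℚ) → ¬ Vertex G
  noVertex G δ≥ v =
    let q , 2<q , qn<2n = δ≥ v (degree<2n (order G) (degree G v) v (∣p∣≤n (N G v)))
    in ℚ.<-irrefl refl (ℚ.≤-<-trans (ℚ.*-monoʳ-≤-nonNeg (fromℕ (order G)) (ℚ.<⇒≤ 2<q)) qn<2n)

δχ : Graph → ℝ (lsuc 0ℓ)
δχ H = inf (ChromaticBounded H)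
  ( fromℚ 2ℚ
  , (1ℚ , ℚ.positive⁻¹ 1ℚ , ℚ.<-trans (*<* (ℤ.+<+ (s≤s (s≤s z≤n)))))
  , 0
  , λ G _ δ≥ → 0 , (((λ v → ⊥-elim (noVertex G δ≥ v)) , λ {u} _ _ → noVertex G δ≥ u) , λ _ _ → z≤n) , z≤n )
  ( 0ℚ , λ ((q , 0<q , q≤γ) , _) γp → ℚ.<-trans 0<q (q≤γ γp) )

δVC : Graph → ℝ (lsuc 0ℓ)
δVC H = inf (VCBounded H)
  ( fromℚ 2ℚ
  , ℚ.<-trans 0<2
  , 0
  , λ G _ δ≥ S shattered → ⊥-elim (noVertex G δ≥ (proj₁ (shattered S (λ x∈S → x∈S)))) )
  ( 0ℚ , proj₁ )

r∸2-nonZero : ∀ {r} → 3 ℕ.≤ r → ℕ.NonZero (r ℕ.∸ 2)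
r∸2-nonZero (s≤s (s≤s (s≤s _))) = _

2r∸3-nonZero : ∀ {r} → 3 ℕ.≤ r → ℕ.NonZero (2 ℕ.* r ℕ.∸ 3)
2r∸3-nonZero 3≤r = ℕ.>-nonZero (ℕ.m<n⇒0<n∸m (ℕ.≤-trans (s≤s (s≤s (s≤s (s≤s z≤n)))) (ℕ.*-monoʳ-≤ 2 3≤r)))

{-# OPTIONS --safe #-}
module Submission where

-- Write r = k + 3 and h = |H|, and call Γ admissible if H maps homomorphically to the join of Γ with K_k.
--
-- The bound k/(k+1) ≤ δVC(H) always holds. Among the admissible Γ that lose admissibility with any edge
-- take one with the most non-isolated vertices. It is not bipartite, so some edge xy is not a bridge.
-- Replace y by m independent copies and Γ - y by 2^m copies indexed by the subsets A of these, joining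
-- x_A to the elements of A and the other neighbours of y in copy A to the non-elements. The resulting
-- gadget is not admissible, since otherwise xy would be a bridge. So a large blow-up of it, joined with
-- k equally large independent sets, is H-free, has minimum degree ratio k/(k+1), and in every maximal H-free
-- extension the pairs (x_A, s) with s ∉ A span no K_{h,h} (which would complete a blow-up of Γ, hence H);
-- picking representatives of the blown-up vertices leaves a shattered set of size m.
--
-- For δχ(H) = (2k+1)/(2k+3), which lies strictly between k/(k+1) and (k+1)/(k+2), suppose δVC(H) is
-- smaller, and take x strictly between max(δVC(H), k/(k+1)) and δχ(H). A maximal H-free graph G of
-- minimum degree ratio x has bounded VC-dimension, so its vertices fall into boundedly many classes of
-- near-twins. Any h vertices of a class A have a common neighbourhood large enough to contain a complete
-- (k+1)-partite graph with parts of size h, so the join of G[A] with k + 1 independent sets of size |A| is H-free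
-- because G is. Its degree ratio (k+1)/(k+2) exceeds δχ(H), hence χ(G[A]) is bounded, and so is χ(G):
-- H-free graphs of minimum degree ratio x < δχ(H) would have bounded chromatic number.

open import Defs
open import Data.Bool using (Bool; true; false; T; not; _∧_; _∨_; _xor_; if_then_else_)
open import Data.Bool.Properties using (T?; T-∧; T-∨; not-injective; xor-comm) renaming (_≟_ to _≟ᵇ_)
open import Data.Empty using (⊥; ⊥-elim)
open import Data.Fin using (Fin; zero; suc; _≟_; inject≤; inject₁; combine; remQuot; funToFin; finToFun; punchIn; splitAt; _↑ˡ_; _↑ʳ_)
open import Data.Fin.Properties using (any?; all?; ¬∀⟶∃¬; injective⇒≤; inject≤-injective; inject₁-injective; suc-injective; remQuot-combine; combine-remQuot; combine-injective; punchInᵢ≢i; punchIn-injective; finToFun-funToFin; ↑ˡ-injective; ↑ʳ-injective; splitAt-↑ˡ; splitAt-↑ʳ)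
open import Data.Fin.Subset using (∣_∣; _∩_)
open import Data.List using (List; []; _∷_; allFin; cartesianProduct)
open import Data.List.Membership.Propositional using () renaming (_∈_ to _∈ˡ_)
open import Data.List.Membership.Propositional.Properties using (∈-cartesianProduct⁺; ∈-allFin)
open import Data.List.Relation.Unary.Any using (here; there)
open import Data.Nat using (ℕ; zero; suc; _+_; _*_; _∸_; _^_; _⊔_; _≤_; _<_; z≤n; s≤s; _≤?_; _<?_; NonZero; >-nonZero) renaming (_/_ to _÷_)
open import Data.Nat.DivMod using (m/n*n≤m; m*n/n≡m; /-monoˡ-≤)
open import Data.Nat.Properties hiding (_≟_; suc-injective)
open import Algebra.Properties.CommutativeMonoid.Sum +-0-commutativeMonoid using (sum; ∑-distrib-+; ∑-comm; sum-cong-≗)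
open import Data.Nat.Tactic.RingSolver using (solve-∀)
open import Data.Product using (∃; Σ; _×_; _,_; proj₁; proj₂; map₂)
open import Data.Sum using (_⊎_; inj₁; inj₂)
open import Data.Vec using (Vec; []; _∷_; tabulate; lookup; map)
open import Data.Vec.Properties using (≡-dec; lookup-map; ∷-injectiveˡ; ∷-injectiveʳ; lookup∘tabulate; lookup-zipWith; lookup⇒[]=; []=⇒lookup; tabulate∘lookup; tabulate-cong)
open import Function using (_∘_; id; Equivalence)
open import Function.Definitions using (Injective)
open import Level using (0ℓ)
open import Relation.Binary.PropositionalEquality
open import Relation.Nullary using (¬_; Dec; yes; no)
open import Relation.Nullary.Decidable using (⌊_⌋; toWitness; fromWitness; _→-dec_; _×-dec_; ¬?; ¬¬-excluded-middle; decidable-stable; map′)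

-- Finite sums, counting and pigeonhole principles

sum-mono : ∀ {n} {f g : Fin n → ℕ} → (∀ i → f i ≤ g i) → sum f ≤ sum g
sum-mono {zero}  f≤g = z≤n
sum-mono {suc n} f≤g = +-mono-≤ (f≤g zero) (sum-mono (f≤g ∘ suc))

sum-const : ∀ n c → sum {n} (λ _ → c) ≡ n * c
sum-const zero    c = refl
sum-const (suc n) c = cong (c +_) (sum-const n c)

sum-*ʳ : ∀ {n} (f : Fin n → ℕ) c → sum (λ i → f i * c) ≡ sum f * c
sum-*ʳ {zero}  f c = refl
sum-*ʳ {suc n} f c = trans (cong (f zero * c +_) (sum-*ʳ (f ∘ suc) c)) (sym (*-distribʳ-+ c (f zero) _))

term≤sum : ∀ {n} (f : Fin n → ℕ) i → f i ≤ sum f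
term≤sum f zero    = m≤m+n _ _
term≤sum f (suc i) = ≤-trans (term≤sum (f ∘ suc) i) (m≤n+m _ (f zero))

-- If every `f i` were below `b`, summing `f i + 1 ≤ b` would contradict the hypothesis. The slack
-- `+ n` expresses an average above `b - 1` without subtraction.
large-term : ∀ {n} (f : Fin n → ℕ) b → n * b < sum f + n → ∃ λ i → b ≤ f i
large-term {n} f b nb<  with any? (λ i → b ≤? f i)
... | yes found = found
... | no  none  = ⊥-elim (<-irrefl refl (<-≤-trans nb< (begin
  sum f + n                 ≡⟨ cong (sum f +_) (trans (sym (*-identityʳ n)) (sym (sum-const n 1))) ⟩
  sum f + sum {n} (λ _ → 1) ≡⟨ ∑-distrib-+ f (λ _ → 1) ⟨
  sum (λ i → f i + 1)       ≤⟨ sum-mono (λ i → subst (_≤ b) (+-comm 1 (f i)) (≰⇒> λ b≤ → none (i , b≤))) ⟩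
  sum {n} (λ _ → b)         ≡⟨ sum-const n b ⟩
  n * b                     ∎)))
  where open ≤-Reasoning

bit : Bool → ℕ
bit true  = 1
bit false = 0

bit-mono : ∀ {a b} → (T a → T b) → bit a ≤ bit b
bit-mono {false}         a⇒b = z≤n
bit-mono {true}  {true}  a⇒b = s≤s z≤n
bit-mono {true}  {false} a⇒b = ⊥-elim (a⇒b _)

count : ∀ {n} → (Fin n → Bool) → ℕ
count p = sum (bit ∘ p)

count-mono : ∀ {n} {p q : Fin n → Bool} → (∀ i → T (p i) → T (q i)) → count p ≤ count q
count-mono p⊆q = sum-mono (bit-mono ∘ p⊆q)

enumerate : ∀ {n} (p : Fin n → Bool) → ∃ λ (e : Fin (count p) → Fin n) →
            Injective _≡_ _≡_ e × (∀ i → T (p (e i))) × (∀ v → T (p v) → ∃ λ i → e i ≡ v)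
enumerate {zero}  p = (λ ()) , (λ {}) , (λ ()) , λ ()
enumerate {suc n} p with enumerate (p ∘ suc)
... | e , e-inj , e-in , e-onto with p zero in eq
...   | false = suc ∘ e , e-inj ∘ suc-injective , e-in , onto
  where
  onto : ∀ v → T (p v) → ∃ λ i → suc (e i) ≡ v
  onto zero    pv = ⊥-elim (subst T eq pv)
  onto (suc v) pv = let i , eᵢ≡v = e-onto v pv in i , cong suc eᵢ≡v
...   | true  = e′ , e′-inj , e′-in , onto
  where
  e′ : Fin (suc (count (p ∘ suc))) → Fin (suc n)
  e′ zero    = zero
  e′ (suc i) = suc (e i)
  e′-inj : Injective _≡_ _≡_ e′
  e′-inj {zero}  {zero}  _  = refl
  e′-inj {suc i} {suc j} eq = cong suc (e-inj (suc-injective eq))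
  e′-in : ∀ i → T (p (e′ i))
  e′-in zero    = subst T (sym eq) _
  e′-in (suc i) = e-in i
  onto : ∀ v → T (p v) → ∃ λ i → e′ i ≡ v
  onto zero    pv = zero , refl
  onto (suc v) pv = let i , eᵢ≡v = e-onto v pv in suc i , cong suc eᵢ≡v

count≥⇒injection : ∀ {n k} (p : Fin n → Bool) → k ≤ count p →
                   ∃ λ (g : Fin k → Fin n) → Injective _≡_ _≡_ g × (∀ i → T (p (g i)))
count≥⇒injection p k≤ =
  let e , e-inj , e-in , _ = enumerate p in
  (λ i → e (inject≤ i k≤)) , (λ eq → inject≤-injective k≤ k≤ _ _ (e-inj eq)) , λ i → e-in (inject≤ i k≤)

injection⇒count≥ : ∀ {n k} (p : Fin n → Bool) (g : Fin k → Fin n) →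
                   Injective _≡_ _≡_ g → (∀ i → T (p (g i))) → k ≤ count p
injection⇒count≥ p g g-inj g-in =
  let e , _ , _ , e-onto = enumerate p
      idx i = proj₁ (e-onto (g i) (g-in i))
      e-idx i = proj₂ (e-onto (g i) (g-in i))
  in injective⇒≤ {f = idx} λ {i} {j} eq → g-inj (trans (sym (e-idx i)) (trans (cong e eq) (e-idx j)))

pigeonholes : ∀ {n K} (p : Fin n → Bool) (f : Fin n → Fin K) h → K * h < count p →
              ∃ λ y → ∃ λ (g : Fin h → Fin n) → Injective _≡_ _≡_ g × (∀ i → T (p (g i)) × f (g i) ≡ y)
pigeonholes {n} {K} p f h Kh< = y , g , g-inj , λ i → let pᵢ , fᵢ = to T-∧ (g-in i) in pᵢ , toWitness fᵢ
  where
  open Equivalence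
  box : Fin K → Fin n → Bool
  box y v = p v ∧ ⌊ f v ≟ y ⌋
  count≤ : count p ≤ sum (λ y → count (box y))
  count≤ = ≤-trans
    (sum-mono λ v → ≤-trans (bit-mono λ pv → from T-∧ (pv , fromWitness refl)) (term≤sum (λ y → bit (box y v)) (f v)))
    (≤-reflexive (∑-comm (λ v y → bit (box y v))))
  found = large-term (λ y → count (box y)) h (<-≤-trans Kh< (≤-trans count≤ (m≤m+n _ K)))
  y = proj₁ found
  inj = count≥⇒injection (box y) (proj₂ found)
  g = proj₁ inj
  g-inj = proj₁ (proj₂ inj)
  g-in = proj₂ (proj₂ inj)

count-all : ∀ n → count {n} (λ _ → true) ≡ n
count-all n = trans (sum-const n 1) (*-identityʳ n)

-- Greedy completion and maximal H-free extensions

-- One pass over the list suffices because a demand once met stays met along `≼`. The double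
-- negation lets a step argue by excluded middle.
greedy : {S I : Set} (_≼_ : S → S → Set) → (∀ {s} → s ≼ s) → (∀ {s t u} → s ≼ t → t ≼ u → s ≼ u) →
         (Done : I → S → Set) → (∀ {i s t} → s ≼ t → Done i s → Done i t) →
         (∀ i s → ¬ ¬ (∃ λ t → s ≼ t × Done i t)) →
         ∀ L s → ¬ ¬ (∃ λ t → s ≼ t × (∀ {i} → i ∈ˡ L → Done i t))
greedy _≼_ ≼-refl ≼-trans Done mono step []      s k = k (s , ≼-refl , λ ())
greedy _≼_ ≼-refl ≼-trans Done mono step (i ∷ L) s k =
  greedy _≼_ ≼-refl ≼-trans Done mono step L s λ (t , s≼t , done) →
  step i t λ (u , t≼u , doneᵢ) →
  k (u , ≼-trans s≼t t≼u , λ { (here refl) → doneᵢ ; (there j∈L) → mono t≼u (done j∈L) })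

allPairs : ∀ n → List (Fin n × Fin n)
allPairs n = cartesianProduct (allFin n) (allFin n)

∈-allPairs : ∀ {n} (u v : Fin n) → (u , v) ∈ˡ allPairs n
∈-allPairs u v = ∈-cartesianProduct⁺ (∈-allFin u) (∈-allFin v)

record EdgeSet (n : ℕ) : Set where
  field
    adjacent   : Fin n → Fin n → Bool
    symmetric  : ∀ {u v} → T (adjacent u v) → T (adjacent v u)
    loopless   : ∀ {v} → ¬ T (adjacent v v)

open EdgeSet public

graph : ∀ {n} → EdgeSet n → Graph
graph E = record { adj = adjacent E ; symm = symmetric E ; irrefl = loopless E }

edges : (G : Graph) → EdgeSet (order G)
edges G = record { adjacent = adj G ; symmetric = symm G ; loopless = irrefl G }

infix 4 _⊑_
_⊑_ : ∀ {n} → EdgeSet n → EdgeSet n → Set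
E ⊑ F = ∀ u v → T (adjacent E u v) → T (adjacent F u v)

Contains-mono : ∀ {n} {E F : EdgeSet n} {H} → E ⊑ F → Contains (graph E) H → Contains (graph F) H
Contains-mono E⊑F (f , f-inj , f-hom) = f , f-inj , E⊑F _ _ ∘ f-hom

addEdge-mono : ∀ {n} {E F : EdgeSet n} u v (u≢v u≢v′ : u ≢ v) → E ⊑ F →
               edges (addEdge (graph E) u v u≢v) ⊑ edges (addEdge (graph F) u v u≢v′)
addEdge-mono {E = E} {F} u v _ _ E⊑F x y e with Equivalence.to (T-∨ {adjacent E x y}) e
... | inj₁ old = Equivalence.from (T-∨ {adjacent F x y}) (inj₁ (E⊑F x y old))
... | inj₂ new = Equivalence.from (T-∨ {adjacent F x y}) (inj₂ new)

⊑-addEdge : ∀ {n} (E : EdgeSet n) u v (u≢v : u ≢ v) → E ⊑ edges (addEdge (graph E) u v u≢v)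
⊑-addEdge E u v u≢v x y e = Equivalence.from (T-∨ {adjacent E x y}) (inj₁ e)

addEdge-new : ∀ {n} (E : EdgeSet n) u v (u≢v : u ≢ v) → Adj (addEdge (graph E) u v u≢v) u v
addEdge-new E u v u≢v = from (T-∨ {adjacent E u v}) (inj₂ (from (T-∨ {⌊ u ≟ u ⌋ ∧ ⌊ v ≟ v ⌋})
  (inj₁ (from (T-∧ {⌊ u ≟ u ⌋}) (fromWitness refl , fromWitness refl)))))
  where open Equivalence

-- A pair whose addition would complete a copy of `H` keeps doing so as further edges arrive, so
-- each pair is examined only once.
maximal-extension : ∀ H G → Free H G → ¬ ¬ (∃ λ (E : EdgeSet (order G)) → edges G ⊑ E × MaximalFree H (graph E))
maximal-extension H G free k =
  greedy (λ s t → proj₁ s ⊑ proj₁ t) (λ _ _ → id) (λ e f u v → f u v ∘ e u v) Done (λ {i} {s} {t} → mono {i} {s} {t}) step (allPairs (order G)) (edges G , free)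
    λ ((E , E-free) , G⊑E , done) → k (E , G⊑E , E-free , λ u v → done (∈-allPairs u v))
  where
  State : Set
  State = Σ (EdgeSet (order G)) (Free H ∘ graph)
  Done : Fin (order G) × Fin (order G) → State → Set
  Done (u , v) (E , _) = (u≢v : u ≢ v) → ¬ T (adjacent E u v) → Contains (addEdge (graph E) u v u≢v) H
  mono : ∀ {i s t} → proj₁ s ⊑ proj₁ t → Done i s → Done i t
  mono {u , v} {E , _} {F , _} E⊑F done u≢v ¬uv =
    Contains-mono {E = edges (addEdge (graph E) u v u≢v)} {edges (addEdge (graph F) u v u≢v)} {H} (addEdge-mono {E = E} {F} u v u≢v u≢v E⊑F) (done u≢v (¬uv ∘ E⊑F u v))
  step : ∀ i s → ¬ ¬ (∃ λ t → proj₁ s ⊑ proj₁ t × Done i t)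
  step (u , v) s@(E , _) k with u ≟ v
  ... | yes u≡v = k (s , (λ _ _ → id) , λ u≢v → ⊥-elim (u≢v u≡v))
  ... | no  u≢v = ¬¬-excluded-middle λ
    { (yes contains) → k (s , (λ _ _ → id) , λ _ _ → contains)
    ; (no  free′)    → k ((edges (addEdge (graph E) u v u≢v) , free′) , ⊑-addEdge E u v u≢v
                         , λ _ ¬uv → ⊥-elim (¬uv (addEdge-new E u v u≢v))) }

∣tabulate∣ : ∀ {n} (p : Fin n → Bool) → ∣ tabulate p ∣ ≡ count p
∣tabulate∣ {zero}  p = refl
∣tabulate∣ {suc n} p with p zero
... | true  = cong suc (∣tabulate∣ (p ∘ suc))
... | false = ∣tabulate∣ (p ∘ suc)

degree-mono : ∀ {n} {E F : EdgeSet n} → E ⊑ F → ∀ v → degree (graph E) v ≤ degree (graph F) v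
degree-mono {E = E} {F} E⊑F v = subst₂ _≤_ (sym (∣tabulate∣ (adjacent E v))) (sym (∣tabulate∣ (adjacent F v)))
  (count-mono (E⊑F v))

-- Realising every pattern forces `p` to be injective: the pattern true only at `i` tells `p i` from
-- every other `p j`. Hence the image of `p` is a shattered set with at least `d` elements.
shattered-points : ∀ G {d C} (p : Fin d → Vertex G) →
                   (∀ (B : Fin d → Bool) → ∃ λ v → ∀ j → adj G v (p j) ≡ B j) → VC≤ G C → d ≤ C
shattered-points G {d} p patterns vc =
  ≤-trans (subst (d ≤_) (sym (∣tabulate∣ inS)) (injection⇒count≥ inS p p-inj λ j → fromWitness (j , refl)))
          (vc S shattered)
  where
  inS : Vertex G → Bool
  inS v = ⌊ any? (λ j → p j ≟ v) ⌋
  S = tabulate inS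
  p-inj : Injective _≡_ _≡_ p
  p-inj {i} {j} eq =
    let v , v-ok = patterns (λ k → ⌊ k ≟ i ⌋)
        Bi : T ⌊ i ≟ i ⌋
        Bi = fromWitness refl
    in sym (toWitness (subst T (trans (sym (v-ok i)) (trans (cong (adj G v) eq) (v-ok j))) Bi))
  shattered : Shattered G S
  shattered A A⊆S = v , trans (sym (tabulate∘lookup _)) (trans (tabulate-cong pointwise) (tabulate∘lookup A))
    where
    pat = patterns (λ j → lookup A (p j))
    v = proj₁ pat
    core : ∀ w → adj G v w ∧ inS w ≡ lookup A w
    core w with any? (λ j → p j ≟ w)
    core w | yes (j , refl) with adj G v (p j) | proj₂ pat j
    ... | true  | eq = eq
    ... | false | eq = eq
    core w | no  none with lookup A w in eq
    ... | false with adj G v w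
    ...   | true  = refl
    ...   | false = refl
    core w | no  none | true = ⊥-elim (none (toWitness (subst T (sym Sw) _)))
      where
      Sw : ⌊ any? (λ j → p j ≟ w) ⌋ ≡ true
      Sw = trans (sym (lookup∘tabulate inS w)) ([]=⇒lookup (A⊆S (lookup⇒[]= w A eq)))
    pointwise : ∀ w → lookup (N G v ∩ S) w ≡ lookup A w
    pointwise w = trans (lookup-zipWith _∧_ w (N G v) S)
      (trans (cong₂ _∧_ (lookup∘tabulate (adj G v) w) (lookup∘tabulate inS w)) (core w))

-- Joins, blow-ups and codes of subsets

abstract
  -- Abstract, so that adjacency in the graphs built below stays opaque and is handled only through
  -- `decide⁺` and `decide⁻`.
  decide : {P : Set} → Dec P → Bool
  decide = ⌊_⌋

  decide⁺ : {P : Set} {P? : Dec P} → P → T (decide P?)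
  decide⁺ = fromWitness

  decide⁻ : {P : Set} {P? : Dec P} → T (decide P?) → P
  decide⁻ = toWitness

-- Vertices are labelled by `d`, and equal labels give non-adjacent twins. Joins, blow-ups, the
-- gadget and induced subgraphs are all of this form.
graphOn : ∀ {X : Set} {n} (R : X → X → Set) → (∀ x y → Dec (R x y)) →
          (∀ {x y} → R x y → R y x) → (∀ {x} → ¬ R x x) → (Fin n → X) → Graph
graphOn {n = n} R R? R-sym R-irr d = record
  { order  = n
  ; adj    = λ u v → decide (R? (d u) (d v))
  ; symm   = λ e → decide⁺ (R-sym (decide⁻ e))
  ; irrefl = λ e → R-irr (decide⁻ e)
  }

Linked : ∀ k (G : Graph) → Fin (suc k) × Vertex G → Fin (suc k) × Vertex G → Set
Linked k G (i , a) (j , b) = i ≡ j → i ≡ zero × Adj G a b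

Linked? : ∀ k G x y → Dec (Linked k G x y)
Linked? k G (i , a) (j , b) = (i ≟ j) →-dec ((i ≟ zero) ×-dec T? (adj G a b))

Linked-sym : ∀ k G {x y} → Linked k G x y → Linked k G y x
Linked-sym k G l j≡i = let i≡0 , ab = l (sym j≡i) in trans j≡i i≡0 , symm G ab

-- The join of G with k independent sets, each as large as G; part zero carries G.
join : ℕ → Graph → Graph
join k G = graphOn {n = suc k * order G} (Linked k G) (Linked? k G)
  (λ {x} {y} → Linked-sym k G {x} {y}) (λ l → irrefl G (proj₂ (l refl))) (remQuot (order G))

join-linked : ∀ k G {x y} → Adj (join k G) x y → Linked k G (remQuot (order G) x) (remQuot (order G) y)
join-linked k G {x} {y} = decide⁻

join-adj : ∀ k G {i j a b} → Linked k G (i , a) (j , b) → Adj (join k G) (combine i a) (combine j b)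
join-adj k G {i} {j} {a} {b} l = decide⁺ (subst₂ (Linked k G) (sym (remQuot-combine i a)) (sym (remQuot-combine j b)) l)

join-degree : ∀ k G x → k * order G ≤ degree (join k G) x
join-degree k G x = subst (k * order G ≤_) (sym (∣tabulate∣ (adj (join k G) x)))
  (injection⇒count≥ (adj (join k G) x) g g-inj g-in)
  where
  i = proj₁ (remQuot {suc k} (order G) x)
  g : Fin (k * order G) → Fin (suc k * order G)
  g y = let j , b = remQuot {k} (order G) y in combine (punchIn i j) b
  g-inj : Injective _≡_ _≡_ g
  g-inj {y} {z} eq =
    let pj , pb = combine-injective (punchIn i _) _ (punchIn i _) _ eq in
    trans (sym (combine-remQuot {k} (order G) y))
      (trans (cong₂ combine (punchIn-injective i _ _ pj) pb) (combine-remQuot {k} (order G) z))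
  g-in : ∀ y → T (adj (join k G) x (g y))
  g-in y = let j , b = remQuot {k} (order G) y in
    decide⁺ (subst (Linked k G _) (sym (remQuot-combine (punchIn i j) b)) λ eq → ⊥-elim (punchInᵢ≢i i j (sym eq)))

-- A homomorphism from H to the join of Γ with K_k; colour zero stands for Γ.
JoinHom : Graph → ℕ → Graph → Set
JoinHom H k Γ = ∃ λ (c : Vertex H → Fin (suc k)) → ∃ λ (f : Vertex H → Vertex Γ) →
                ∀ {u v} → Adj H u v → c u ≡ c v → c u ≡ zero × Adj Γ (f u) (f v)

JoinHom-map : ∀ {H k Γ Γ′} (g : Vertex Γ → Vertex Γ′) → (∀ {a b} → Adj Γ a b → Adj Γ′ (g a) (g b)) →
              JoinHom H k Γ → JoinHom H k Γ′
JoinHom-map g g-hom (c , f , ok) = c , g ∘ f , λ e eq → map₂ g-hom (ok e eq)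

Contains⇒JoinHom : ∀ {H k G} → Contains (join k G) H → JoinHom H k G
Contains⇒JoinHom {H} {k} {G} (g , _ , g-hom) =
  proj₁ ∘ remQuot (order G) ∘ g , proj₂ ∘ remQuot {suc k} (order G) ∘ g , λ {u} {v} e → join-linked k G {g u} {g v} (g-hom e)

blowup : ℕ → Graph → Graph
blowup N G = graphOn {n = order G * N} (Adj G) (λ a b → T? (adj G a b)) (symm G) (irrefl G) (proj₁ ∘ remQuot N)

infix 4 _∋_ _∋?_
-- `Fin (2 ^ m)` stands for the power set of `Fin m`, each subset being coded by its characteristic
-- function.
_∋_ : ∀ {m} → Fin (2 ^ m) → Fin m → Set
_∋_ {m} A s = finToFun {2} {m} A s ≡ suc zero

_∋?_ : ∀ {m} (A : Fin (2 ^ m)) s → Dec (A ∋ s)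
_∋?_ {m} A s = finToFun {2} {m} A s ≟ suc zero

encode : ∀ {m} → (Fin m → Bool) → Fin (2 ^ m)
encode B = funToFin (λ j → if B j then suc zero else zero)

encode-∋ : ∀ {m} (B : Fin m → Bool) {j} → B j ≡ true → encode B ∋ j
encode-∋ B {j} eq = trans (finToFun-funToFin _ j) (cong (λ b → if b then suc zero else zero) eq)

encode-∌ : ∀ {m} (B : Fin m → Bool) {j} → B j ≡ false → ¬ encode B ∋ j
encode-∌ B {j} eq mem with trans (sym (trans (finToFun-funToFin _ j) (cong (λ b → if b then suc zero else zero) eq))) mem
... | ()

-- Edge-minimal admissible graphs

removeEdge : ∀ {n} → EdgeSet n → Fin n → Fin n → EdgeSet n
removeEdge {n} E u v = edges (graphOn R R? R-sym (loopless E ∘ proj₁) id)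
  where
  R : Fin n → Fin n → Set
  R a b = T (adjacent E a b) × ¬ (a ≡ u × b ≡ v) × ¬ (b ≡ u × a ≡ v)
  R? : ∀ a b → Dec (R a b)
  R? a b = T? (adjacent E a b) ×-dec ¬? ((a ≟ u) ×-dec (b ≟ v)) ×-dec ¬? ((b ≟ u) ×-dec (a ≟ v))
  R-sym : ∀ {a b} → R a b → R b a
  R-sym (e , p , q) = symmetric E e , q , p

removeEdge-adj : ∀ {n} (E : EdgeSet n) u v {a b} → T (adjacent E a b) → ¬ (a ≡ u × b ≡ v) → ¬ (b ≡ u × a ≡ v) →
                 T (adjacent (removeEdge E u v) a b)
removeEdge-adj E u v e p q = decide⁺ (e , p , q)

removeEdge-⊑ : ∀ {n} (E : EdgeSet n) u v → removeEdge E u v ⊑ E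
removeEdge-⊑ E u v a b e = proj₁ (decide⁻ e)

removeEdge-mono : ∀ {n} {E F : EdgeSet n} u v → E ⊑ F → removeEdge E u v ⊑ removeEdge F u v
removeEdge-mono {E = E} {F} u v E⊑F a b e =
  let ab , p , q = decide⁻ e in removeEdge-adj F u v (E⊑F a b ab) p q

removeEdge-gone : ∀ {n} (E : EdgeSet n) u v → ¬ T (adjacent (removeEdge E u v) u v)
removeEdge-gone E u v e = proj₁ (proj₂ (decide⁻ e)) (refl , refl)

JoinHom-⊑ : ∀ {H k n} {E F : EdgeSet n} → E ⊑ F → JoinHom H k (graph E) → JoinHom H k (graph F)
JoinHom-⊑ E⊑F (c , f , ok) = c , f , λ e eq → map₂ (E⊑F _ _) (ok e eq)

Tight : Graph → ℕ → ∀ {n} → EdgeSet n → Set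
Tight H k E = ∀ u v → T (adjacent E u v) → ¬ JoinHom H k (graph (removeEdge E u v))

-- `greedy` on the reversed inclusion: an edge whose removal destroys every homomorphism remains
-- indispensable after further removals.
tighten : ∀ {H k n} (F : EdgeSet n) → JoinHom H k (graph F) →
          ¬ ¬ (∃ λ (E : EdgeSet n) → E ⊑ F × JoinHom H k (graph E) × Tight H k E)
tighten {H} {k} {n} F hom K =
  greedy (λ s t → proj₁ t ⊑ proj₁ s) (λ _ _ → id) (λ e f u v → e u v ∘ f u v) Done (λ {i} {s} {t} → mono {i} {s} {t}) step
    (allPairs n) (F , hom)
    λ ((E , E-hom) , E⊑F , done) → K (E , E⊑F , E-hom , λ u v → done (∈-allPairs u v))
  where
  State : Set
  State = Σ (EdgeSet n) (JoinHom H k ∘ graph)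
  Done : Fin n × Fin n → State → Set
  Done (u , v) (E , _) = T (adjacent E u v) → ¬ JoinHom H k (graph (removeEdge E u v))
  mono : ∀ {i s t} → proj₁ t ⊑ proj₁ s → Done i s → Done i t
  mono {u , v} {E , _} {E′ , _} E′⊑E done uv = done (E′⊑E u v uv)
    ∘ JoinHom-⊑ {H} {E = removeEdge E′ u v} {removeEdge E u v} (removeEdge-mono {E = E′} {E} u v E′⊑E)
  step : ∀ i s → ¬ ¬ (∃ λ t → proj₁ t ⊑ proj₁ s × Done i t)
  step (u , v) s@(E , _) K = ¬¬-excluded-middle λ
    { (yes hom′) → K ((removeEdge E u v , hom′) , removeEdge-⊑ E u v , λ uv → ⊥-elim (removeEdge-gone E u v uv))
    ; (no  none) → K (s , (λ _ _ → id) , λ _ → none) }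

-- A homomorphism that did not use the edge would survive its removal, against tightness.
tight-onto : ∀ {H k n} {E : EdgeSet n} → Tight H k E → ((c , f , _) : JoinHom H k (graph E)) →
             ∀ z z′ → T (adjacent E z z′) → ∃ λ u → ∃ λ v → Adj H u v × c u ≡ c v × f u ≡ z × f v ≡ z′
tight-onto {H} {k} {n} {E} tight (c , f , ok) z z′ zz′
  with any? (λ u → any? (λ v → T? (adj H u v) ×-dec (c u ≟ c v) ×-dec (f u ≟ z) ×-dec (f v ≟ z′)))
... | yes found = found
... | no  none  = ⊥-elim (tight z z′ zz′ (c , f , λ {u} {v} e eq →
  let c≡0 , fe = ok e eq in
  c≡0 , removeEdge-adj E z z′ fe (λ (p , q) → none (u , v , e , eq , p , q))
                                 (λ (p , q) → none (v , u , symm H e , sym eq , p , q))))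

-- Bridges, bipartite graphs and the gadget

-- `U` is one side of a cut crossed by no edge other than xy; a cut avoids any talk of paths and
-- components.
Bridge : (Γ : Graph) → Vertex Γ → Vertex Γ → Set
Bridge Γ x y = ∃ λ (U : Vertex Γ → Bool) → U x ≢ U y ×
  (∀ z z′ → Adj Γ z z′ → U z ≡ U z′ ⊎ (z ≡ x × z′ ≡ y) ⊎ (z ≡ y × z′ ≡ x))

xor-cancelʳ : ∀ {a b} u → a xor u ≡ b xor u → a ≡ b
xor-cancelʳ {false} {false} u eq = refl
xor-cancelʳ {true}  {true}  u eq = refl
xor-cancelʳ {false} {true}  false ()
xor-cancelʳ {false} {true}  true ()
xor-cancelʳ {true}  {false} false ()
xor-cancelʳ {true}  {false} true ()

xor-cancelˡ : ∀ a {u v} → a xor u ≡ a xor v → u ≡ v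
xor-cancelˡ false eq = eq
xor-cancelˡ true  eq = not-injective eq

-- Flipping a colouring along the cut of a bridge changes whether it separates the ends of that edge, and of no other.
bridges⇒2-colouring : ∀ Γ → (∀ x y → Adj Γ x y → ¬ ¬ Bridge Γ x y) →
                      ¬ ¬ (∃ λ (c : Vertex Γ → Bool) → ∀ x y → Adj Γ x y → c x ≢ c y)
bridges⇒2-colouring Γ bridge K = go (allPairs (order Γ)) λ (c , proper) → K (c , λ x y → proper (∈-allPairs x y))
  where
  Good : List (Vertex Γ × Vertex Γ) → Set
  Good L = ∃ λ (c : Vertex Γ → Bool) → ∀ {x y} → (x , y) ∈ˡ L → Adj Γ x y → c x ≢ c y
  go : ∀ L → ¬ ¬ Good L
  go []            K = K ((λ _ → true) , λ ())
  go ((x , y) ∷ L) K = go L λ (c , proper) → extend c proper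
    where
    extend : (c : Vertex Γ → Bool) → (∀ {x y} → (x , y) ∈ˡ L → Adj Γ x y → c x ≢ c y) → ⊥
    extend c proper with T? (adj Γ x y) | c x ≟ᵇ c y
    ... | no ¬xy | _ = K (c , λ { (here refl) xy → ⊥-elim (¬xy xy) ; (there z∈) → proper z∈ })
    ... | yes _ | no c≢ = K (c , λ { (here refl) _ → c≢ ; (there z∈) → proper z∈ })
    ... | yes xy | yes c≡ = bridge x y xy λ (U , Ux≢Uy , only) →
      K ((λ z → c z xor U z) ,
         λ { (here refl) _ eq → Ux≢Uy (xor-cancelˡ (c x) (trans eq (cong (_xor U y) (sym c≡))))
           ; {z} {z′} (there z∈) e eq → case-of U z z′ z∈ e eq (only z z′ e) })
      where
      case-of : ∀ (U : Vertex Γ → Bool) z z′ → (z , z′) ∈ˡ L → Adj Γ z z′ → c z xor U z ≡ c z′ xor U z′ →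
                U z ≡ U z′ ⊎ (z ≡ x × z′ ≡ y) ⊎ (z ≡ y × z′ ≡ x) → ⊥
      case-of U z z′ z∈ e eq (inj₁ same) = proper z∈ e (xor-cancelʳ (U z′) (subst (λ u → c z xor u ≡ c z′ xor U z′) same eq))
      case-of U z z′ z∈ e eq (inj₂ (inj₁ (refl , refl))) = proper z∈ e c≡
      case-of U z z′ z∈ e eq (inj₂ (inj₂ (refl , refl))) = proper z∈ e (sym c≡)

joinColour : ∀ {k} → Fin (suc k) → Bool → Fin (2 + k)
joinColour zero    true  = zero
joinColour zero    false = suc zero
joinColour (suc i) _     = suc (suc i)

joinColour-injective : ∀ {k} {i j : Fin (suc k)} {a b} → joinColour i a ≡ joinColour j b → i ≡ j × (i ≡ zero → a ≡ b)
joinColour-injective {i = zero}  {zero}  {true}  {true}  _    = refl , λ _ → refl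
joinColour-injective {i = zero}  {zero}  {false} {false} _    = refl , λ _ → refl
joinColour-injective {i = zero}  {suc j} {true}  ()
joinColour-injective {i = zero}  {suc j} {false} ()
joinColour-injective {i = suc i} {zero}  {_} {true} ()
joinColour-injective {i = suc i} {zero}  {_} {false} ()
joinColour-injective {i = suc i} {suc j} refl = refl , λ ()

-- Part `zero` of the join needs two colours when Γ is bipartite, and each of the `k` other parts
-- needs one.
2-colouring⇒Colourable : ∀ {H k Γ} → JoinHom H k Γ → (b : Vertex Γ → Bool) → (∀ x y → Adj Γ x y → b x ≢ b y) →
                         Colourable H (2 + k)
2-colouring⇒Colourable (c , f , ok) b proper =
  (λ u → joinColour (c u) (b (f u))) , λ e eq →
  let c≡ , b≡ = joinColour-injective eq ; c≡0 , fe = ok e c≡ in proper _ _ fe (b≡ c≡0)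

-- m copies of y and 2^m copies of Γ - y; a copy A of x is joined to the copies s of y with A ∋ s,
-- the copy A of any other neighbour of y to those with ¬ A ∋ s. (The redundant coordinate of a
-- vertex (z , A , s), s when z ≢ y and A when z ≡ y, only produces twins.)
module _ (Γ : Graph) (x y : Vertex Γ) (m : ℕ) where

  Code : Set
  Code = Vertex Γ × Fin (2 ^ m) × Fin m

  code : Fin (order Γ * (2 ^ m * m)) → Code
  code w = let z , As = remQuot (2 ^ m * m) w in z , remQuot m As

  decode : Code → Fin (order Γ * (2 ^ m * m))
  decode (z , A , s) = combine z (combine A s)

  code-decode : ∀ w → code (decode w) ≡ w
  code-decode (z , A , s) = trans
    (cong (λ (z , As) → z , remQuot m As) (remQuot-combine z (combine A s)))
    (cong (z ,_) (remQuot-combine A s))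

  Chosen : Vertex Γ → Fin (2 ^ m) → Fin m → Set
  Chosen z A s = (z ≡ x → A ∋ s) × (A ∋ s → z ≡ x)

  Wire : Code → Code → Set
  Wire (z , A , s) (z′ , A′ , s′) =
    Adj Γ z z′ × (z ≢ y → z′ ≢ y → A ≡ A′) × (z′ ≡ y → Chosen z A s′) × (z ≡ y → Chosen z′ A′ s)

  Chosen? : ∀ z A s → Dec (Chosen z A s)
  Chosen? z A s = ((z ≟ x) →-dec (A ∋? s)) ×-dec ((A ∋? s) →-dec (z ≟ x))

  Wire? : ∀ w w′ → Dec (Wire w w′)
  Wire? (z , A , s) (z′ , A′ , s′) =
    T? (adj Γ z z′) ×-dec (¬? (z ≟ y) →-dec (¬? (z′ ≟ y) →-dec (A ≟ A′)))
    ×-dec ((z′ ≟ y) →-dec Chosen? z A s′) ×-dec ((z ≟ y) →-dec Chosen? z′ A′ s)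

  Wire-sym : ∀ {w w′} → Wire w w′ → Wire w′ w
  Wire-sym (e , p , q , r) = symm Γ e , (λ a b → sym (p b a)) , r , q

  gadget : Graph
  gadget = graphOn Wire Wire? Wire-sym (irrefl Γ ∘ proj₁) code

  gadget-wire : ∀ {w w′} → Adj gadget w w′ → Wire (code w) (code w′)
  gadget-wire = decide⁻

  gadget-adj : ∀ {w w′} → Wire w w′ → Adj gadget (decode w) (decode w′)
  gadget-adj {w} {w′} e = decide⁺ (subst₂ Wire (sym (code-decode w)) (sym (code-decode w′)) e)

-- A gadget that is not admissible

K₃ : Graph
K₃ = graphOn {n = 3} _≢_ (λ a b → ¬? (a ≟ b)) (λ ne → ne ∘ sym) (λ ne → ne refl) id

-- The join of `K₃` with a complete graph on `k` vertices is complete on `3 + k` vertices, so a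
-- colouring is a homomorphism to it. This provides a first admissible graph.
Colourable⇒JoinHom : ∀ {H k} → Colourable H (3 + k) → JoinHom H k K₃
Colourable⇒JoinHom {H} {k} (col , proper) = part ∘ col , shade ∘ col , λ e → sep (proper e)
  where
  part : Fin (3 + k) → Fin (suc k)
  part (suc (suc (suc i))) = suc i
  part _                   = zero
  shade : Fin (3 + k) → Fin 3
  shade zero          = zero
  shade (suc zero)    = suc zero
  shade _             = suc (suc zero)
  sep : ∀ {a b} → a ≢ b → part a ≡ part b → part a ≡ zero × Adj K₃ (shade a) (shade b)
  sep {zero}           {zero}           ne _ = ⊥-elim (ne refl)
  sep {zero}           {suc zero}       ne _ = refl , decide⁺ λ ()
  sep {zero}           {suc (suc zero)} ne _ = refl , decide⁺ λ ()
  sep {suc zero}       {zero}           ne _ = refl , decide⁺ λ ()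
  sep {suc zero}       {suc zero}       ne _ = ⊥-elim (ne refl)
  sep {suc zero}       {suc (suc zero)} ne _ = refl , decide⁺ λ ()
  sep {suc (suc zero)} {zero}           ne _ = refl , decide⁺ λ ()
  sep {suc (suc zero)} {suc zero}       ne _ = refl , decide⁺ λ ()
  sep {suc (suc zero)} {suc (suc zero)} ne _ = ⊥-elim (ne refl)
  sep {suc (suc (suc i))} {suc (suc (suc j))} ne eq = ⊥-elim (ne (cong (λ i → suc (suc i)) eq))

hasNeighbour? : ∀ {n} (E : EdgeSet n) w → Dec (∃ λ w′ → T (adjacent E w w′))
hasNeighbour? E w = any? (λ w′ → T? (adjacent E w w′))

module _ (H : Graph) (k m : ℕ) where

  -- `ι` lists `j` of the non-isolated vertices. Asking for `Spread j` but not `Spread (suc j)`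
  -- amounts to choosing a graph with the most of them.
  Spread : ℕ → Set
  Spread j = ∃ λ n → ∃ λ (E : EdgeSet n) → JoinHom H k (graph E) × Tight H k E ×
    ∃ λ (ι : Fin j → Fin n) → Injective _≡_ _≡_ ι × (∀ i → ∃ λ w → T (adjacent E (ι i) w))

  -- By `tight-onto` each listed vertex is the image of some vertex of `H`.
  Spread-bounded : ∀ {j} → Spread j → j ≤ order H
  Spread-bounded (n , E , hom@(c , f , _) , tight , ι , ι-inj , nbr) =
    injective⇒≤ {f = pre} λ {i} {j} eq → ι-inj (trans (sym (f-pre i)) (trans (cong f eq) (f-pre j)))
    where
    lift = λ i → tight-onto {H} {k} {E = E} tight hom (ι i) (proj₁ (nbr i)) (proj₂ (nbr i))
    pre = λ i → proj₁ (lift i)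
    f-pre : ∀ i → f (pre i) ≡ ι i
    f-pre i = proj₁ (proj₂ (proj₂ (proj₂ (proj₂ (lift i)))))

  -- A non-isolated vertex missed by `ι` could be prepended to it, giving `Spread (suc j)`.
  Spread-exact : ∀ {j n} {E : EdgeSet n} → ¬ Spread (suc j) → JoinHom H k (graph E) → Tight H k E →
    (ι : Fin j → Fin n) → Injective _≡_ _≡_ ι → (∀ i → ∃ λ w → T (adjacent E (ι i) w)) →
    ∀ {w w′} → T (adjacent E w w′) → ∃ λ i → ι i ≡ w
  Spread-exact {j} {n} {E} max hom tight ι ι-inj nbr {w} {w′} ww′ with any? (λ i → ι i ≟ w)
  ... | yes found = found
  ... | no  none  = ⊥-elim (max (n , E , hom , tight , ι′ , ι′-inj , nbr′))
    where
    ι′ : Fin (suc j) → Fin n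
    ι′ zero    = w
    ι′ (suc i) = ι i
    ι′-inj : Injective _≡_ _≡_ ι′
    ι′-inj {zero}  {zero}  _  = refl
    ι′-inj {zero}  {suc i} eq = ⊥-elim (none (i , sym eq))
    ι′-inj {suc i} {zero}  eq = ⊥-elim (none (i , eq))
    ι′-inj {suc i} {suc l} eq = cong suc (ι-inj eq)
    nbr′ : ∀ i → ∃ λ w → T (adjacent E (ι′ i) w)
    nbr′ zero    = w′ , ww′
    nbr′ (suc i) = nbr i

  -- If Γ has as many non-isolated vertices as possible, a tight subgraph of the gadget projects
  -- injectively to Γ, and the copies A ∋ s (for the copy s of y in use) form a cut of Γ crossed only by xy.
  lift⇒bridge : ∀ {j n} {E : EdgeSet n} → Tight H k E →
    (ι : Fin j → Fin n) → Injective _≡_ _≡_ ι → (∀ i → ∃ λ w → T (adjacent E (ι i) w)) → ¬ Spread (suc j) →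
    ∀ x y → T (adjacent E x y) → (F : EdgeSet (n * (2 ^ m * m))) → F ⊑ edges (gadget (graph E) x y m) →
    JoinHom H k (graph F) → Tight H k F → Bridge (graph E) x y
  lift⇒bridge {j} {n} {E} tightE ι ι-inj nbr max x y xy F F⊑ homF tightF = U , Ux≢Uy , only
    where
    Cd = code (graph E) x y m
    π : Fin (n * (2 ^ m * m)) → Fin n
    π w = proj₁ (Cd w)
    pat : Fin (n * (2 ^ m * m)) → Fin (2 ^ m)
    pat w = proj₁ (proj₂ (Cd w))
    idx : Fin (n * (2 ^ m * m)) → Fin m
    idx w = proj₂ (proj₂ (Cd w))
    wire : ∀ {w w′} → T (adjacent F w w′) → Wire (graph E) x y m (Cd w) (Cd w′)
    wire e = gadget-wire (graph E) x y m (F⊑ _ _ e)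
    -- Projecting back to Γ gives a homomorphism into Γ, which by tightness of `E` uses every edge;
    -- so every edge of Γ lifts to `F`.
    homE : JoinHom H k (graph E)
    homE = JoinHom-map {H} {Γ = graph F} {graph E} π (λ e → proj₁ (wire e)) homF
    lift : ∀ z z′ → T (adjacent E z z′) → ∃ λ w → ∃ λ w′ → T (adjacent F w w′) × π w ≡ z × π w′ ≡ z′
    lift z z′ e =
      let c , f , ok = homF ; u , v , uv , c≡ , p , q = tight-onto {H} {k} {E = E} tightE homE z z′ e in
      f u , f v , proj₂ (ok uv c≡) , p , q
    ι′ : Fin j → Fin (n * (2 ^ m * m))
    ι′ i = proj₁ (lift (ι i) (proj₁ (nbr i)) (proj₂ (nbr i)))
    π-ι′ : ∀ i → π (ι′ i) ≡ ι i
    π-ι′ i = let _ , _ , _ , p , _ = lift (ι i) (proj₁ (nbr i)) (proj₂ (nbr i)) in p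
    ι′-inj : Injective _≡_ _≡_ ι′
    ι′-inj {a} {b} eq = ι-inj (trans (sym (π-ι′ a)) (trans (cong π eq) (π-ι′ b)))
    nbr′ : ∀ i → ∃ λ w → T (adjacent F (ι′ i) w)
    nbr′ i = let _ , w′ , e , _ = lift (ι i) (proj₁ (nbr i)) (proj₂ (nbr i)) in w′ , e
    -- The lifts `ι′` already exhaust the non-isolated vertices of `F`, so `π` is injective on
    -- these.
    unique : ∀ {w v w′ v′} → T (adjacent F w v) → T (adjacent F w′ v′) → π w ≡ π w′ → w ≡ w′
    unique e e′ eq =
      let a , a≡ = Spread-exact {E = F} max homF tightF ι′ ι′-inj nbr′ e
          b , b≡ = Spread-exact {E = F} max homF tightF ι′ ι′-inj nbr′ e′
      in trans (sym a≡) (trans (cong ι′ (ι-inj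
           (trans (sym (π-ι′ a)) (trans (cong π a≡) (trans eq (trans (cong π (sym b≡)) (π-ι′ b))))))) b≡)
    top = lift x y xy
    wx = proj₁ top
    wy = proj₁ (proj₂ top)
    wxy = proj₁ (proj₂ (proj₂ top))
    πwx≡x = proj₁ (proj₂ (proj₂ (proj₂ top)))
    πwy≡y = proj₂ (proj₂ (proj₂ (proj₂ top)))
    s = idx wy
    Inside : Fin n → Set
    Inside z = z ≢ y × ∃ λ w → π w ≡ z × (∃ λ v → T (adjacent F w v)) × pat w ∋ s
    inside? : ∀ z → Dec (Inside z)
    inside? z = ¬? (z ≟ y) ×-dec any? (λ w → (π w ≟ z) ×-dec hasNeighbour? F w ×-dec (pat w ∋? s))
    U : Fin n → Bool
    U z = ⌊ inside? z ⌋
    ⌊⌋-cong : ∀ {P Q : Set} {P? : Dec P} {Q? : Dec Q} → (P → Q) → (Q → P) → ⌊ P? ⌋ ≡ ⌊ Q? ⌋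
    ⌊⌋-cong {P? = yes p} {yes q} f g = refl
    ⌊⌋-cong {P? = yes p} {no ¬q} f g = ⊥-elim (¬q (f p))
    ⌊⌋-cong {P? = no ¬p} {yes q} f g = ⊥-elim (¬p (g q))
    ⌊⌋-cong {P? = no ¬p} {no ¬q} f g = refl
    x≢y : x ≢ y
    x≢y refl = loopless E xy
    x-inside : Inside x
    x-inside = x≢y , wx , πwx≡x , (wy , wxy) , proj₁ (proj₁ (proj₂ (proj₂ (wire wxy))) πwy≡y) πwx≡x
    Ux≢Uy : U x ≢ U y
    Ux≢Uy eq = proj₁ (toWitness {a? = inside? y} (subst T eq (fromWitness x-inside))) refl
    -- The lift of the edge zy must end in `wy`, the only copy of y in use, and there the wiring
    -- allows a copy with `A ∋ s` only for x.
    at-y : ∀ z → T (adjacent E z y) → Inside z → z ≡ x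
    at-y z e (_ , w , πw≡z , (_ , we) , w∋s) =
      let a , b , ab , πa≡z , πb≡y = lift z y e
          b≡wy = unique (symmetric F ab) (symmetric F wxy) (trans πb≡y (sym πwy≡y))
          a≡w = unique ab we (trans πa≡z (sym πw≡z))
      in trans (sym πa≡z) (proj₂ (proj₁ (proj₂ (proj₂ (wire ab))) πb≡y)
           (subst₂ (λ w i → pat w ∋ i) (sym a≡w) (cong idx (sym b≡wy)) w∋s))
    -- Away from y the wiring stays within one copy of Γ - y, so membership of `s` is inherited.
    along : ∀ z z′ → T (adjacent E z z′) → z′ ≢ y → Inside z → Inside z′
    along z z′ e z′≢y (z≢y , w , πw≡z , (_ , we) , w∋s) =
      let a , b , ab , πa≡z , πb≡z′ = lift z z′ e
          a≡w = unique ab we (trans πa≡z (sym πw≡z))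
          same = proj₁ (proj₂ (wire ab)) (λ p → z≢y (trans (sym πa≡z) p)) (λ p → z′≢y (trans (sym πb≡z′) p))
      in z′≢y , b , πb≡z′ , (a , symmetric F ab) , subst (_∋ s) same (subst (λ w → pat w ∋ s) (sym a≡w) w∋s)
    only : ∀ z z′ → T (adjacent E z z′) → U z ≡ U z′ ⊎ (z ≡ x × z′ ≡ y) ⊎ (z ≡ y × z′ ≡ x)
    only z z′ e = cases (z ≟ y) (z′ ≟ y) (z ≟ x) (z′ ≟ x)
      where
      cases : Dec (z ≡ y) → Dec (z′ ≡ y) → Dec (z ≡ x) → Dec (z′ ≡ x) →
              U z ≡ U z′ ⊎ (z ≡ x × z′ ≡ y) ⊎ (z ≡ y × z′ ≡ x)
      cases (yes z≡y) (yes z′≡y) _ _ = inj₁ (cong U (trans z≡y (sym z′≡y)))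
      cases (no z≢y) (no z′≢y) _ _ =
        inj₁ (⌊⌋-cong {P? = inside? z} {inside? z′} (along z z′ e z′≢y) (along z′ z (symmetric E e) z≢y))
      cases (no _) (yes z′≡y) (yes z≡x) _ = inj₂ (inj₁ (z≡x , z′≡y))
      cases (no _) (yes refl) (no z≢x) _ =
        inj₁ (⌊⌋-cong {P? = inside? z} {inside? z′} (λ i → ⊥-elim (z≢x (at-y z e i))) λ i → ⊥-elim (proj₁ i refl))
      cases (yes z≡y) (no _) _ (yes z′≡x) = inj₂ (inj₂ (z≡y , z′≡x))
      cases (yes refl) (no _) _ (no z′≢x) =
        inj₁ (⌊⌋-cong {P? = inside? z} {inside? z′} (λ i → ⊥-elim (proj₁ i refl))
          λ i → ⊥-elim (z′≢x (at-y z′ (symmetric E e) i)))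

  -- If all gadgets were admissible, `Spread j` would give `Spread (suc j)`: otherwise every edge
  -- would be a bridge, Γ bipartite and `H` colourable with `2 + k` colours. Climbing past `order H`
  -- contradicts `Spread-bounded`.
  separating-gadget : Colourable H (3 + k) → ¬ Colourable H (2 + k) →
    ¬ ¬ (∃ λ Γ → ∃ λ x → ∃ λ y → Adj Γ x y × JoinHom H k Γ × ¬ JoinHom H k (gadget Γ x y m))
  separating-gadget col ¬col K = climb (suc (order H)) λ spread → <-irrefl refl (Spread-bounded spread)
    where
    climb : ∀ j → ¬ ¬ Spread j
    climb zero    K′ = tighten {H} (edges K₃) (Colourable⇒JoinHom {H} col) λ (E , _ , hom , tight) →
      K′ (3 , E , hom , tight , (λ ()) , (λ {}) , λ ())
    climb (suc j) K′ = climb j λ (n , E , hom , tight , ι , ι-inj , nbr) →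
      bridges⇒2-colouring (graph E)
        (λ x y xy ¬bridge → K (graph E , x , y , xy , hom , λ homQ →
          tighten {H} (edges (gadget (graph E) x y m)) homQ λ (F , F⊑ , homF , tightF) →
          ¬bridge (lift⇒bridge {E = E} tight ι ι-inj nbr K′ x y xy F F⊑ homF tightF)))
        (λ (b , proper) → ¬col (2-colouring⇒Colourable {H} {k} {graph E} hom b proper))

-- Shattered sets in maximal extensions of the blown-up gadget

reflect : ∀ {a b} → (b ≡ true → T a) → (b ≡ false → ¬ T a) → a ≡ b
reflect {true}  {true}  p q = refl
reflect {true}  {false} p q = ⊥-elim (q refl _)
reflect {false} {true}  p q = ⊥-elim (p refl)
reflect {false} {false} p q = refl

module _ (H : Graph) (k m : ℕ) (s₀ : Fin m) (Γ : Graph) (x y : Vertex Γ) (hom : JoinHom H k Γ)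
         (no-hom : ¬ JoinHom H k (gadget Γ x y m)) (M N₀ : ℕ) (h≤N₀ : order H ≤ N₀) (M≤N₀ : M ≤ N₀)
         (M-large : 2 ^ m * suc (order H) < M) (N₀-large : m * M ^ order H * suc (order H) < N₀) where

  private
    h P : ℕ
    h = order H
    P = 2 ^ m

    low : Fin M → Fin N₀
    low a = inject≤ a M≤N₀

    high : Fin h → Fin N₀
    high a = inject≤ a h≤N₀

    B G₀ : Graph
    B = blowup N₀ (gadget Γ x y m)
    G₀ = join k B

    vtx : Fin (suc k) → Code Γ x y m → Fin N₀ → Vertex G₀
    vtx i w b = combine i (combine (decode Γ x y m w) b)

    vtx-adj : ∀ {i j w w′ b b′} → (i ≡ j → i ≡ zero × Wire Γ x y m w w′) → Adj G₀ (vtx i w b) (vtx j w′ b′)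
    vtx-adj {w = w} {w′} {b} {b′} l = join-adj k B λ eq → map₂
      (λ e → decide⁺ (subst₂ (Adj (gadget Γ x y m))
        (sym (cong proj₁ (remQuot-combine (decode Γ x y m w) b)))
        (sym (cong proj₁ (remQuot-combine (decode Γ x y m w′) b′)))
        (gadget-adj Γ x y m {w} {w′} e)))
      (l eq)

    vtx-injective : ∀ {i j w w′ b b′} → vtx i w b ≡ vtx j w′ b′ → w ≡ w′ × b ≡ b′
    vtx-injective {i} {j} {w} {w′} {b} {b′} eq =
      let _ , eq′ = combine-injective i _ j _ eq
          p , q = combine-injective (decode Γ x y m w) b (decode Γ x y m w′) b′ eq′
      in trans (sym (code-decode Γ x y m w)) (trans (cong (code Γ x y m) p) (code-decode Γ x y m w′)) , q

    G₀-free : Free H G₀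
    G₀-free contains = no-hom (JoinHom-map {H} {k} {B} {gadget Γ x y m} (λ v → proj₁ (remQuot N₀ v)) decide⁻
      (Contains⇒JoinHom {H} {k} {B} contains))

    ∅ : Fin P
    ∅ = encode {m} (λ _ → false)

    X : Fin P → Fin N₀ → Vertex G₀
    X A b = vtx zero (x , A , s₀) b

    Y : Fin m → Fin N₀ → Vertex G₀
    Y s a = vtx zero (y , ∅ , s) a

  -- When s is not in A, copy A of Γ - y together with copy s of y forms Γ without the edge xy. The
  -- biclique restores that edge on `h` copies of either end, and the resulting blow-up of Γ, joined
  -- with the independent sets, has room for `H`.
  biclique⇒Contains : (E : EdgeSet (order G₀)) → edges G₀ ⊑ E → ∀ A s → ¬ A ∋ s →
    (α β : Fin h → Fin N₀) → Injective _≡_ _≡_ α → Injective _≡_ _≡_ β →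
    (∀ i j → Adj (graph E) (X A (β i)) (Y s (α j))) → Contains (graph E) H
  biclique⇒Contains E G₀⊑E A s A∌s α β α-inj β-inj biclique = g , g-inj , λ {u} {v} → g-hom u v
    where
    c = proj₁ hom
    f = proj₁ (proj₂ hom)
    ok = proj₂ (proj₂ hom)
    -- The redundant coordinates are filled with `∅` and `s₀` as in `Y` and `X`, so that the
    -- biclique lies on the chosen representatives.
    spot : ∀ z → Dec (z ≡ y) → Dec (z ≡ x) → Code Γ x y m × (Fin h → Fin N₀)
    spot z (yes _) _       = (z , ∅ , s) , α
    spot z (no _)  (yes _) = (z , A , s₀) , β
    spot z (no _)  (no _)  = (z , A , s₀) , high
    place : Fin (suc k) → Code Γ x y m × (Fin h → Fin N₀) → Fin h → Vertex G₀
    place i (w , e) u = vtx i w (e u)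
    spot-base : ∀ z p q → proj₁ (proj₁ (spot z p q)) ≡ z
    spot-base z (yes _) _       = refl
    spot-base z (no _)  (yes _) = refl
    spot-base z (no _)  (no _)  = refl
    spot-inj : ∀ z p q → Injective _≡_ _≡_ (proj₂ (spot z p q))
    spot-inj z (yes _) _       eq = α-inj eq
    spot-inj z (no _)  (yes _) eq = β-inj eq
    spot-inj z (no _)  (no _)  eq = inject≤-injective _ _ _ _ eq
    at : ∀ z → Code Γ x y m × (Fin h → Fin N₀)
    at z = spot z (z ≟ y) (z ≟ x)
    old : ∀ {w w′ b b′} → Wire Γ x y m w w′ → Adj (graph E) (vtx zero w b) (vtx zero w′ b′)
    old {w} {w′} {b} {b′} e = G₀⊑E (vtx zero w b) (vtx zero w′ b′) (vtx-adj {zero} {zero} {w} {w′} {b} {b′} λ _ → refl , e)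
    edge : ∀ z z′ p q p′ q′ → Adj Γ z z′ → ∀ u v → Adj (graph E) (place zero (spot z p q) u) (place zero (spot z′ p′ q′) v)
    edge z z′ (yes refl) _ (yes refl) _ e u v = ⊥-elim (irrefl Γ e)
    edge z z′ (yes refl) _ (no z′≢y) (yes refl) e u v = symmetric E (biclique v u)
    edge z z′ (yes refl) _ (no z′≢y) (no z′≢x) e u v = old
      (e , (λ y≢y _ → ⊥-elim (y≢y refl)) , (λ z′≡y → ⊥-elim (z′≢y z′≡y))
         , λ _ → (λ z′≡x → ⊥-elim (z′≢x z′≡x)) , λ A∋s → ⊥-elim (A∌s A∋s))
    edge z z′ (no z≢y) (yes refl) (yes refl) _ e u v = biclique u v
    edge z z′ (no z≢y) (no z≢x) (yes refl) _ e u v = old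
      (e , (λ _ y≢y → ⊥-elim (y≢y refl))
         , (λ _ → (λ z≡x → ⊥-elim (z≢x z≡x)) , λ A∋s → ⊥-elim (A∌s A∋s)) , λ z≡y → ⊥-elim (z≢y z≡y))
    edge z z′ (no z≢y) (yes _) (no z′≢y) (yes _) e u v = old
      (e , (λ _ _ → refl) , (λ z′≡y → ⊥-elim (z′≢y z′≡y)) , λ z≡y → ⊥-elim (z≢y z≡y))
    edge z z′ (no z≢y) (yes _) (no z′≢y) (no _) e u v = old
      (e , (λ _ _ → refl) , (λ z′≡y → ⊥-elim (z′≢y z′≡y)) , λ z≡y → ⊥-elim (z≢y z≡y))
    edge z z′ (no z≢y) (no _) (no z′≢y) (yes _) e u v = old
      (e , (λ _ _ → refl) , (λ z′≡y → ⊥-elim (z′≢y z′≡y)) , λ z≡y → ⊥-elim (z≢y z≡y))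
    edge z z′ (no z≢y) (no _) (no z′≢y) (no _) e u v = old
      (e , (λ _ _ → refl) , (λ z′≡y → ⊥-elim (z′≢y z′≡y)) , λ z≡y → ⊥-elim (z≢y z≡y))
    g : Vertex H → Vertex G₀
    -- Vertex `u` of `H` takes the `u`-th copy, which keeps apart vertices with the same image in Γ.
    g u = place (c u) (at (f u)) u
    g-inj : Injective _≡_ _≡_ g
    g-inj {u} {v} eq =
      let w≡ , b≡ = vtx-injective {c u} {c v} {proj₁ (at (f u))} {proj₁ (at (f v))} {proj₂ (at (f u)) u} {proj₂ (at (f v)) v} eq
          f≡ = trans (sym (spot-base (f u) (f u ≟ y) (f u ≟ x))) (trans (cong proj₁ w≡) (spot-base (f v) (f v ≟ y) (f v ≟ x)))
      in spot-inj (f u) (f u ≟ y) (f u ≟ x) (trans b≡ (cong (λ z → proj₂ (at z) v) (sym f≡)))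
    g-hom : ∀ u v → Adj H u v → Adj (graph E) (g u) (g v)
    g-hom u v e = split (c u ≟ c v)
      where
      split : Dec (c u ≡ c v) → Adj (graph E) (g u) (g v)
      split (no  c≢) = G₀⊑E (g u) (g v)
        (vtx-adj {c u} {c v} {proj₁ (at (f u))} {proj₁ (at (f v))} {proj₂ (at (f u)) u} {proj₂ (at (f v)) v} λ c≡ → ⊥-elim (c≢ c≡))
      split (yes c≡) =
        let c≡0 , fe = ok e c≡ in
        subst₂ (λ i j → Adj (graph E) (place i (at (f u)) u) (place j (at (f v)) v)) (sym c≡0) (trans (sym c≡0) c≡)
          (edge (f u) (f v) (f u ≟ y) (f u ≟ x) (f v ≟ y) (f v ≟ x) fe u v)

  -- First a copy of each x_A that is not bad is chosen, then a copy of each s not blocked by these.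
  -- The chosen vertices are adjacent exactly when `A ∋ s`, so the `m` chosen copies of y are
  -- shattered. Only the first `M` copies of each s compete, which keeps the number of `h`-tuples of
  -- them below `N₀`.
  gadget-shatters : Adj Γ x y → ∀ D → (∀ G → MaximalFree H G → (∀ v → k * order G ≤ degree G v * suc k) → VC≤ G D) → ¬ ¬ m ≤ D
  gadget-shatters xy D vc≤ m≰D = maximal-extension H G₀ G₀-free λ (E , G₀⊑E , max) → m≰D (contradict E G₀⊑E max)
    where
    contradict : (E : EdgeSet (order G₀)) → edges G₀ ⊑ E → MaximalFree H (graph E) → m ≤ D
    contradict E G₀⊑E max@(free , _) = shattered-points (graph E) p patterns (vc≤ (graph E) max deg)
      where
      deg : ∀ v → k * order G₀ ≤ degree (graph E) v * suc k
      deg v = begin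
        k * (suc k * order B)           ≡⟨ cong (k *_) (*-comm (suc k) (order B)) ⟩
        k * (order B * suc k)           ≡⟨ *-assoc k (order B) (suc k) ⟨
        k * order B * suc k             ≤⟨ *-monoˡ-≤ (suc k) (≤-trans (join-degree k B v) (degree-mono {E = edges G₀} {E} G₀⊑E v)) ⟩
        degree (graph E) v * suc k      ∎
        where open ≤-Reasoning
      hit : Fin P → Fin m → Fin N₀ → Fin M → Bool
      hit A s b a = adjacent E (X A b) (Y s (low a))
      Bad : Fin P → Fin N₀ → Set
      Bad A b = ∃ λ s → ¬ A ∋ s × h ≤ count (hit A s b)
      bad? : ∀ A b → Dec (Bad A b)
      bad? A b = any? (λ s → ¬? (A ∋? s) ×-dec (h ≤? count (hit A s b)))
      -- Each bad copy selects some s and `h` neighbours among `M` vertices; among `N₀` copies, more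
      -- than `h` select the same ones, and this is a forbidden biclique.
      not-all-bad : ∀ A → ¬ (∀ b → Bad A b)
      not-all-bad A bad = free (biclique⇒Contains E G₀⊑E A s (proj₁ (proj₂ (bad b₀)))
          (λ i → low (inj b₀ i)) (λ i → β (inject₁ i))
          (λ eq → proj₁ (proj₂ (injection b₀)) (inject≤-injective _ _ _ _ eq)) (λ eq → inject₁-injective (β-inj eq)) biclique)
        where
        injection = λ b → count≥⇒injection (hit A (proj₁ (bad b)) b) (proj₂ (proj₂ (bad b)))
        inj : Fin N₀ → Fin h → Fin M
        inj b = proj₁ (injection b)
        box : Fin N₀ → Fin (m * M ^ h)
        box b = combine (proj₁ (bad b)) (funToFin (inj b))
        -- One more than `h`, so that index `zero` exists as a reference even when `H` has no
        -- vertices.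
        full = pigeonholes (λ _ → true) box (suc h)
          (subst (m * M ^ h * suc h <_) (sym (count-all N₀)) N₀-large)
        β = proj₁ (proj₂ full)
        β-inj = proj₁ (proj₂ (proj₂ full))
        b₀ = β zero
        s = proj₁ (bad b₀)
        same : ∀ i → box (β i) ≡ box b₀
        same i = trans (proj₂ (proj₂ (proj₂ (proj₂ full)) i)) (sym (proj₂ (proj₂ (proj₂ (proj₂ full)) zero)))
        same-s : ∀ i → proj₁ (bad (β i)) ≡ s
        same-s i = proj₁ (combine-injective (proj₁ (bad (β i))) (funToFin (inj (β i))) s (funToFin (inj b₀)) (same i))
        same-inj : ∀ i j → inj (β i) j ≡ inj b₀ j
        same-inj i j = trans (sym (finToFun-funToFin (inj (β i)) j)) (trans
          (cong (λ e → finToFun {M} {h} e j)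
            (proj₂ (combine-injective (proj₁ (bad (β i))) (funToFin (inj (β i))) s (funToFin (inj b₀)) (same i))))
          (finToFun-funToFin (inj b₀) j))
        biclique : ∀ i j → Adj (graph E) (X A (β (inject₁ i))) (Y s (low (inj b₀ j)))
        biclique i j = subst₂ (λ s a → Adj (graph E) (X A (β (inject₁ i))) (Y s (low a)))
          (same-s (inject₁ i)) (same-inj (inject₁ i) j) (proj₂ (proj₂ (injection (β (inject₁ i)))) j)
      some-good : ∀ A → ∃ λ b → ¬ Bad A b
      some-good A = ¬∀⟶∃¬ N₀ (Bad A) (bad? A) (not-all-bad A)
      good : Fin P → Fin N₀
      good A = proj₁ (some-good A)
      Blocked : Fin m → Fin M → Set
      Blocked s a = ∃ λ A → ¬ A ∋ s × T (hit A s (good A) a)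
      blocked? : ∀ s a → Dec (Blocked s a)
      blocked? s a = any? (λ A → ¬? (A ∋? s) ×-dec T? (hit A s (good A) a))
      -- Otherwise one A blocks more than `h` of the `M` positions, and its chosen copy of x would
      -- be bad.
      not-all-blocked : ∀ s → ¬ (∀ a → Blocked s a)
      not-all-blocked s blocked = proj₂ (some-good A) (s , A∌s , ≤-trans (n≤1+n h) (injection⇒count≥ _ α α-inj α-hit))
        where
        full = pigeonholes (λ _ → true) (λ a → proj₁ (blocked a)) (suc h) (subst (P * suc h <_) (sym (count-all M)) M-large)
        A = proj₁ full
        α = proj₁ (proj₂ full)
        α-inj = proj₁ (proj₂ (proj₂ full))
        in-A : ∀ i → proj₁ (blocked (α i)) ≡ A
        in-A i = proj₂ (proj₂ (proj₂ (proj₂ full)) i)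
        A∌s : ¬ A ∋ s
        A∌s = subst (λ A → ¬ A ∋ s) (in-A zero) (proj₁ (proj₂ (blocked (α zero))))
        α-hit : ∀ i → T (hit A s (good A) (α i))
        α-hit i = subst (λ A → T (hit A s (good A) (α i))) (in-A i) (proj₂ (proj₂ (blocked (α i))))
      some-free : ∀ s → ∃ λ a → ¬ Blocked s a
      some-free s = ¬∀⟶∃¬ M (Blocked s) (blocked? s) (not-all-blocked s)
      p : Fin m → Vertex G₀
      p s = Y s (low (proj₁ (some-free s)))
      patterns : ∀ (Bs : Fin m → Bool) → ∃ λ v → ∀ j → adj (graph E) v (p j) ≡ Bs j
      patterns Bs = X A (good A) , agree
        where
        A = encode Bs
        x≢y : x ≢ y
        x≢y x≡y = irrefl Γ (subst (Adj Γ x) (sym x≡y) xy)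
        agree : ∀ j → adj (graph E) (X A (good A)) (p j) ≡ Bs j
        agree j = reflect
          (λ eq → G₀⊑E (X A (good A)) (p j) (vtx-adj {zero} {zero} {x , A , s₀} {y , ∅ , j} {good A} {low (proj₁ (some-free j))}
            λ _ → refl , xy , (λ _ y≢y → ⊥-elim (y≢y refl)) , (λ _ → (λ _ → encode-∋ Bs eq) , λ _ → refl) , λ x≡y → ⊥-elim (x≢y x≡y)))
          (λ eq e → proj₂ (some-free j) (A , encode-∌ Bs eq , e))

no-VC-bound : ∀ H k D → Colourable H (3 + k) → ¬ Colourable H (2 + k) →
  ¬ (∀ G → MaximalFree H G → (∀ v → k * order G ≤ degree G v * suc k) → VC≤ G D)
no-VC-bound H k D col ¬col vc≤ = separating-gadget H k m col ¬col λ (Γ , x , y , xy , hom , no-hom) →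
  gadget-shatters H k m zero Γ x y hom no-hom M N₀ (m≤n+m h (suc (m * M ^ h * suc h) + M)) (≤-trans (m≤n+m M (suc (m * M ^ h * suc h))) (m≤m+n _ h)) ≤-refl
    (s≤s (≤-trans (m≤m+n _ M) (m≤m+n _ h))) xy D vc≤ (<-irrefl refl)
  where
  m = suc D
  h = order H
  M = suc (2 ^ m * suc h)
  -- The summands serve `N₀-large`, `M≤N₀` and `h≤N₀` in turn.
  N₀ = suc (m * M ^ h * suc h) + M + h

-- The Sauer-Shelah lemma

countVec : ∀ {s} → (Vec Bool s → Bool) → ℕ
countVec {zero}  P = bit (P [])
countVec {suc s} P = countVec (P ∘ (true ∷_)) + countVec (P ∘ (false ∷_))

bit-∨-∧ : ∀ a b → bit a + bit b ≡ bit (a ∨ b) + bit (a ∧ b)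
bit-∨-∧ true  b     = cong suc (sym (+-identityˡ _))
bit-∨-∧ false b     = sym (+-identityʳ _)

countVec-∨-∧ : ∀ {s} (P Q : Vec Bool s → Bool) →
               countVec P + countVec Q ≡ countVec (λ x → P x ∨ Q x) + countVec (λ x → P x ∧ Q x)
countVec-∨-∧ {zero}  P Q = bit-∨-∧ (P []) (Q [])
countVec-∨-∧ {suc s} P Q = begin
  (countVec P₁ + countVec P₀) + (countVec Q₁ + countVec Q₀)       ≡⟨ regroup (countVec P₁) _ _ _ ⟩
  (countVec P₁ + countVec Q₁) + (countVec P₀ + countVec Q₀)       ≡⟨ cong₂ _+_ (countVec-∨-∧ P₁ Q₁) (countVec-∨-∧ P₀ Q₀) ⟩
  _                                                               ≡⟨ regroup (countVec (λ x → P₁ x ∨ Q₁ x)) _ _ _ ⟩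
  _                                                               ∎
  where
  open ≡-Reasoning
  P₁ = P ∘ (true ∷_)
  P₀ = P ∘ (false ∷_)
  Q₁ = Q ∘ (true ∷_)
  Q₀ = Q ∘ (false ∷_)
  regroup : ∀ a b c d → (a + b) + (c + d) ≡ (a + c) + (b + d)
  regroup = solve-∀

countVec-witness : ∀ {s} (P : Vec Bool s → Bool) → 0 < countVec P → ∃ λ x → T (P x)
countVec-witness {zero}  P 0< with P [] in eq
... | true = [] , subst T (sym eq) _
countVec-witness {suc s} P 0< with 0 <? countVec (P ∘ (true ∷_))
... | yes 0<₁ = let x , Px = countVec-witness (P ∘ (true ∷_)) 0<₁ in true ∷ x , Px
... | no  0≮₁ =
  let x , Px = countVec-witness (P ∘ (false ∷_)) (subst (λ c → 0 < c + countVec (P ∘ (false ∷_))) (n≤0⇒n≡0 (≮⇒≥ 0≮₁)) 0<)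
  in false ∷ x , Px

bitIndex : ∀ {b} → T b → Fin (bit b)
bitIndex {true} _ = zero

-- The rank of `x` among the vectors satisfying `P`; its injectivity bounds any number of distinct
-- such vectors by `countVec P`.
vecIndex : ∀ {s} (P : Vec Bool s → Bool) x → T (P x) → Fin (countVec P)
vecIndex P []          Px = bitIndex Px
vecIndex P (true  ∷ x) Px = vecIndex (P ∘ (true ∷_)) x Px ↑ˡ countVec (P ∘ (false ∷_))
vecIndex P (false ∷ x) Px = countVec (P ∘ (true ∷_)) ↑ʳ vecIndex (P ∘ (false ∷_)) x Px

↑ˡ≢↑ʳ : ∀ {m n} (i : Fin m) (j : Fin n) → i ↑ˡ n ≢ m ↑ʳ j
↑ˡ≢↑ʳ {m} {n} i j eq with trans (sym (splitAt-↑ˡ m i n)) (trans (cong (splitAt m) eq) (splitAt-↑ʳ m n j))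
... | ()

vecIndex-injective : ∀ {s} (P : Vec Bool s → Bool) {x y} (Px : T (P x)) (Py : T (P y)) →
                     vecIndex P x Px ≡ vecIndex P y Py → x ≡ y
vecIndex-injective P {[]}        {[]}        Px Py eq = refl
vecIndex-injective P {true  ∷ x} {true  ∷ y} Px Py eq = cong (true ∷_) (vecIndex-injective _ Px Py (↑ˡ-injective _ _ _ eq))
vecIndex-injective P {false ∷ x} {false ∷ y} Px Py eq = cong (false ∷_) (vecIndex-injective _ Px Py (↑ʳ-injective _ _ _ eq))
vecIndex-injective P {true  ∷ x} {false ∷ y} Px Py eq = ⊥-elim (↑ˡ≢↑ʳ _ _ eq)
vecIndex-injective P {false ∷ x} {true  ∷ y} Px Py eq = ⊥-elim (↑ˡ≢↑ʳ _ _ (sym eq))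

-- The sum of the binomial coefficients (s choose i) over i < d.
sauer : ℕ → ℕ → ℕ
sauer s       zero    = 0
sauer zero    (suc d) = 1
sauer (suc s) (suc d) = sauer s (suc d) + sauer s d

Shatters : ∀ {s} → (Vec Bool s → Bool) → ℕ → Set
Shatters {s} P d = ∃ λ (ι : Fin d → Fin s) → ∀ (B : Fin d → Bool) → ∃ λ x → T (P x) × (∀ j → lookup x (ι j) ≡ B j)

-- Deleting the first coordinate splits the count: `∨` counts the projections and `∧` those that
-- extend both ways. If the projections are many they shatter a large set; otherwise the `∧` family
-- shatters `d` coordinates, to which the first one can be added.
sauer-shelah : ∀ s d (P : Vec Bool s → Bool) → sauer s d < countVec P → Shatters P d
sauer-shelah s zero P 0< = (λ ()) , λ _ → let x , Px = countVec-witness P 0< in x , Px , λ ()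
sauer-shelah zero (suc d) P 1< with P []
sauer-shelah zero (suc d) P (s≤s ()) | true
sauer-shelah zero (suc d) P ()       | false
sauer-shelah (suc s) (suc d) P big with sauer s (suc d) <? countVec (λ x → P (true ∷ x) ∨ P (false ∷ x))
... | yes big∨ =
  let ι , realise = sauer-shelah s (suc d) _ big∨ in
  suc ∘ ι , λ B → let x , Px , ok = realise B in pick ι B x Px ok
  where
  pick : ∀ (ι : Fin (suc d) → Fin s) (B : Fin (suc d) → Bool) x → T (P (true ∷ x) ∨ P (false ∷ x)) → (∀ j → lookup x (ι j) ≡ B j) →
         ∃ λ x → T (P x) × (∀ j → lookup x (suc (ι j)) ≡ B j)
  pick ι B x Px ok with Equivalence.to (T-∨ {P (true ∷ x)}) Px
  ... | inj₁ P₁ = true ∷ x , P₁ , ok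
  ... | inj₂ P₀ = false ∷ x , P₀ , ok
... | no  small∨ =
  let ι , realise = sauer-shelah s d (λ x → P (true ∷ x) ∧ P (false ∷ x)) big∧ in
  (λ { zero → zero ; (suc j) → suc (ι j) }) ,
  λ B → let x , Px , ok = realise (B ∘ suc) ; P₁ , P₀ = Equivalence.to (T-∧ {P (true ∷ x)}) Px in
        B zero ∷ x , both (B zero) x P₁ P₀ , λ { zero → refl ; (suc j) → ok j }
  where
  both : ∀ b x → T (P (true ∷ x)) → T (P (false ∷ x)) → T (P (b ∷ x))
  both true  x P₁ P₀ = P₁
  both false x P₁ P₀ = P₀
  big∧ : sauer s d < countVec (λ x → P (true ∷ x) ∧ P (false ∷ x))
  big∧ = +-cancelˡ-< (sauer s (suc d)) _ _ (<-≤-trans big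
    (≤-trans (≤-reflexive (countVec-∨-∧ (P ∘ (true ∷_)) (P ∘ (false ∷_)))) (+-monoˡ-≤ _ (≮⇒≥ small∨))))

-- Numerical estimates

sauer≤^ : ∀ s d → sauer s d ≤ suc s ^ d
sauer≤^ s       zero    = z≤n
sauer≤^ zero    (suc d) = ≤-reflexive (sym (^-zeroˡ (suc d)))
sauer≤^ (suc s) (suc d) = begin
  sauer s (suc d) + sauer s d        ≤⟨ +-mono-≤ (sauer≤^ s (suc d)) (sauer≤^ s d) ⟩
  suc s * suc s ^ d + suc s ^ d      ≡⟨ +-comm _ (suc s ^ d) ⟩
  suc (suc s) * suc s ^ d            ≤⟨ *-monoʳ-≤ (suc (suc s)) (^-monoˡ-≤ d (n≤1+n (suc s))) ⟩
  suc (suc s) * suc (suc s) ^ d      ∎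
  where open ≤-Reasoning

-- Bernoulli's inequality for `(1 + 1/q) ^ n`, with denominators cleared.
bernoulli : ∀ q n → q ^ n * (q + n) ≤ q * suc q ^ n
bernoulli q zero    = ≤-reflexive (trans (+-identityʳ _) (trans (+-identityʳ q) (sym (*-identityʳ q))))
bernoulli q (suc n) = begin
  q * q ^ n * (q + suc n)            ≤⟨ m≤m+n _ (q ^ n * n) ⟩
  q * q ^ n * (q + suc n) + q ^ n * n ≡⟨ expand q n (q ^ n) ⟩
  suc q * (q ^ n * (q + n))          ≤⟨ *-monoʳ-≤ (suc q) (bernoulli q n) ⟩
  suc q * (q * suc q ^ n)            ≡⟨ shuffle q (suc q ^ n) ⟩
  q * (suc q * suc q ^ n)            ∎
  where
  open ≤-Reasoning
  expand : ∀ q n x → q * x * (q + suc n) + x * n ≡ suc q * (x * (q + n))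
  expand = solve-∀
  shuffle : ∀ q x → suc q * (q * x) ≡ q * (suc q * x)
  shuffle = solve-∀

doubling : ∀ q → 2 * q ^ suc q ≤ suc q ^ suc q
doubling zero      = z≤n
doubling q@(suc _) = *-cancelˡ-≤ q (begin
  q * (2 * q ^ suc q)      ≡⟨ shuffle q (q ^ suc q) ⟩
  q ^ suc q * (q + q)      ≤⟨ *-monoʳ-≤ (q ^ suc q) (+-monoʳ-≤ q (n≤1+n q)) ⟩
  q ^ suc q * (q + suc q)  ≤⟨ bernoulli q (suc q) ⟩
  q * suc q ^ suc q        ∎)
  where
  open ≤-Reasoning
  shuffle : ∀ q x → q * (2 * x) ≡ x * (q + q)
  shuffle = solve-∀

power-gap : ∀ q t → 2 ^ t * q ^ (suc q * t) ≤ suc q ^ (suc q * t)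
power-gap q t = begin
  2 ^ t * q ^ (suc q * t)          ≡⟨ cong (2 ^ t *_) (sym (^-*-assoc q (suc q) t)) ⟩
  2 ^ t * (q ^ suc q) ^ t          ≡⟨ *-^ 2 (q ^ suc q) t ⟨
  (2 * q ^ suc q) ^ t              ≤⟨ ^-monoˡ-≤ t (doubling q) ⟩
  (suc q ^ suc q) ^ t              ≡⟨ ^-*-assoc (suc q) (suc q) t ⟩
  suc q ^ (suc q * t)              ∎
  where
  open ≤-Reasoning
  *-^ : ∀ a b t → (a * b) ^ t ≡ a ^ t * b ^ t
  *-^ a b zero    = refl
  *-^ a b (suc t) = trans (cong (a * b *_) (*-^ a b t)) (interchange a b (a ^ t) (b ^ t))
    where
    interchange : ∀ a b x y → a * b * (x * y) ≡ a * x * (b * y)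
    interchange = solve-∀

n<2^n : ∀ n → n < 2 ^ n
n<2^n zero    = s≤s z≤n
n<2^n (suc n) = begin-strict
  suc n          <⟨ +-mono-≤-< (≤-trans (s≤s z≤n) (n<2^n n)) (n<2^n n) ⟩
  2 ^ n + 2 ^ n  ≡⟨ cong (2 ^ n +_) (+-identityʳ (2 ^ n)) ⟨
  2 * 2 ^ n      ∎
  where open ≤-Reasoning

-- With `u = e + e + f` the left side is at most `u * u + u`, which is below `suc u * suc u` and
-- hence below `2 ^ u * 2 ^ u`.
linear<exponential : ∀ e f → ∃ λ b → e * b + f < 2 ^ b
linear<exponential e f = u + u , (begin-strict
  e * (u + u) + f            ≤⟨ +-monoʳ-≤ (e * (u + u)) (m≤n+m f (e + e)) ⟩
  e * (u + u) + u            <⟨ n<1+n _ ⟩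
  suc (e * (u + u) + u)      ≤⟨ s≤s (+-monoˡ-≤ u (≤-trans (≤-reflexive (swap₂ e u)) (*-monoˡ-≤ u (m≤m+n (e + e) f)))) ⟩
  suc (u * u + u)            ≤⟨ s≤s (m≤n+m (u * u + u) u) ⟩
  suc (u + (u * u + u))      ≡⟨ square u ⟩
  suc u * suc u              ≤⟨ *-mono-≤ (n<2^n u) (n<2^n u) ⟩
  2 ^ u * 2 ^ u              ≡⟨ ^-distribˡ-+-* 2 u u ⟨
  2 ^ (u + u)                ∎)
  where
  open ≤-Reasoning
  u = e + e + f
  swap₂ : ∀ e u → e * (u + u) ≡ (e + e) * u
  swap₂ = solve-∀
  square : ∀ u → suc (u + (u * u + u)) ≡ suc u * suc u
  square = solve-∀

-- a bounds log₂ of the number of pairwise far rows, s is the number of columns needed to separate them.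
separation-size : ∀ q d → ∃ λ a → ∃ λ s → q ^ s * (2 ^ a * 2 ^ a) < suc q ^ s × sauer s d < 2 ^ a
separation-size q d = a , s , gap , ≤-<-trans (sauer≤^ s d) small
  where
  c = suc q
  -- The linear form equals `suc s` for the `a` and `s` below. The exponent is raised from `d` to
  -- `suc d` so that `suc s < 2 ^ b` gives a strict inequality of powers even for `d = 0`.
  lin = linear<exponential (c * 2 * suc d) (suc c)
  b = proj₁ lin
  a = suc d * b
  -- The summand 1 beyond `a + a` gives `power-gap` a spare factor 2, which makes `gap` strict.
  s = c * suc (a + a)
  small : suc s ^ d < 2 ^ a
  small = begin-strict
    suc s ^ d            ≤⟨ ^-monoʳ-≤ (suc s) (n≤1+n d) ⟩
    suc s ^ suc d        <⟨ ^-monoˡ-< (suc d) (subst (_< 2 ^ b) (regroup c d b) (proj₂ lin)) ⟩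
    (2 ^ b) ^ suc d      ≡⟨ ^-*-assoc 2 b (suc d) ⟩
    2 ^ (b * suc d)      ≡⟨ cong (2 ^_) (*-comm b (suc d)) ⟩
    2 ^ a                ∎
    where
    open ≤-Reasoning
    regroup : ∀ c d b → c * 2 * suc d * b + suc c ≡ suc (c * suc (suc d * b + suc d * b))
    regroup = solve-∀
  x+x≤y⇒x<y : ∀ {x y} → x + x ≤ y → 0 < y → x < y
  x+x≤y⇒x<y {zero}  _    0<y = 0<y
  x+x≤y⇒x<y {suc x} x+x≤ _   = ≤-trans (s≤s (m<m+n x (s≤s z≤n))) x+x≤
  gap : q ^ s * (2 ^ a * 2 ^ a) < suc q ^ s
  gap = x+x≤y⇒x<y (≤-trans (≤-reflexive double) (power-gap q (suc (a + a)))) (m^n>0 (suc q) s)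
    where
    twice : ∀ x y → x * y + x * y ≡ 2 * y * x
    twice = solve-∀
    double : q ^ s * (2 ^ a * 2 ^ a) + q ^ s * (2 ^ a * 2 ^ a) ≡ 2 ^ suc (a + a) * q ^ s
    double = trans (twice (q ^ s) (2 ^ a * 2 ^ a)) (cong (λ y → 2 * y * q ^ s) (sym (^-distribˡ-+-* 2 a a)))

-- Separating columns and nets of near-twins

bit-split : ∀ a b → bit a ≡ bit (a ∧ not b) + bit (a ∧ b)
bit-split true  true  = refl
bit-split true  false = refl
bit-split false b     = refl

-- Double counting: every `e` in `w` is separated by at least a `1/(q+1)` fraction of the columns,
-- so some column separates that fraction of the `e` in `w`.
separating-point : ∀ q {M n} (w : Fin M → Bool) (d : Fin M → Fin n → Bool) → 0 < n →
  (∀ e → T (w e) → n ≤ suc q * count (d e)) →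
  ∃ λ x → suc q * count (λ e → w e ∧ not (d e x)) ≤ q * count w
separating-point q {M} {n} w d 0<n far = x , +-cancelʳ-≤ (count w) _ _ (begin
  suc q * count (kept x) + count w           ≤⟨ +-monoʳ-≤ (suc q * count (kept x)) many ⟩
  suc q * count (kept x) + count (cut x) * suc q ≡⟨ factor (suc q) (count (kept x)) (count (cut x)) ⟩
  suc q * (count (kept x) + count (cut x))   ≡⟨ cong (suc q *_) (sym (split x)) ⟩
  suc q * count w                            ≡⟨ +-comm (count w) (q * count w) ⟩
  q * count w + count w                      ∎)
  where
  open ≤-Reasoning
  kept cut : Fin n → Fin M → Bool
  kept x e = w e ∧ not (d e x)
  cut  x e = w e ∧ d e x
  factor : ∀ q a b → q * a + b * q ≡ q * (a + b)
  factor = solve-∀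
  split : ∀ x → count w ≡ count (kept x) + count (cut x)
  split x = trans (sum-cong-≗ λ e → bit-split (w e) (d e x)) (∑-distrib-+ (bit ∘ kept x) (bit ∘ cut x))
  row : ∀ e → bit (w e) * n ≤ count (λ x → cut x e) * suc q
  row e with w e | far e
  ... | true  | far = ≤-trans (≤-reflexive (+-identityʳ n)) (≤-trans (far _) (≤-reflexive (*-comm (suc q) _)))
  ... | false | _   = z≤n
  total : n * count w ≤ sum (λ x → count (cut x) * suc q)
  total = begin
    n * count w                                       ≡⟨ *-comm n (count w) ⟩
    count w * n                                       ≡⟨ sum-*ʳ (bit ∘ w) n ⟨
    sum (λ e → bit (w e) * n)                         ≤⟨ sum-mono row ⟩
    sum (λ e → count (λ x → cut x e) * suc q)         ≡⟨ sum-*ʳ (λ e → count (λ x → cut x e)) (suc q) ⟩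
    sum (λ e → count (λ x → cut x e)) * suc q         ≡⟨ cong (_* suc q) (∑-comm (λ e x → bit (cut x e))) ⟩
    sum (λ x → count (cut x)) * suc q                 ≡⟨ sum-*ʳ (λ x → count (cut x)) (suc q) ⟨
    sum (λ x → count (cut x) * suc q)                 ∎
  found = large-term (λ x → count (cut x) * suc q) (count w) (≤-<-trans total (m<m+n _ 0<n))
  x = proj₁ found
  many = proj₂ found

-- Each new column separates at least a 1/(q+1) fraction of the pairs of rows not yet separated.
module _ (q : ℕ) {m n : ℕ} (row : Fin m → Fin n → Bool) (0<n : 0 < n)
         (far : ∀ i j → i ≢ j → n ≤ suc q * count (λ x → row i x xor row j x)) where

  fst snd : Fin (m * m) → Fin m
  fst e = proj₁ (remQuot {m} m e)
  snd e = proj₂ (remQuot {m} m e)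

  confused : ∀ {s} → Vec (Fin n) s → Fin (m * m) → Bool
  confused []       e = not ⌊ fst e ≟ snd e ⌋
  confused (x ∷ xs) e = confused xs e ∧ not (row (fst e) x xor row (snd e) x)

  confused⇒distinct : ∀ {s} (xs : Vec (Fin n) s) e → T (confused xs e) → fst e ≢ snd e
  confused⇒distinct []       e c eq with fst e ≟ snd e
  ... | yes _ = c
  ... | no ne = ne eq
  confused⇒distinct (x ∷ xs) e c = confused⇒distinct xs e (proj₁ (Equivalence.to T-∧ c))

  separate : ∀ s → ∃ λ (xs : Vec (Fin n) s) → suc q ^ s * count (confused xs) ≤ q ^ s * (m * m)
  separate zero    = [] , *-monoʳ-≤ 1 (≤-trans (count-mono {p = confused []} {λ _ → true} (λ _ _ → _)) (≤-reflexive (count-all (m * m))))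
  separate (suc s) =
    let xs , few = separate s
        x , fewer = separating-point q (confused xs) (λ e x → row (fst e) x xor row (snd e) x) 0<n
                      (λ e c → far _ _ (confused⇒distinct xs e c))
    in x ∷ xs , (begin
      suc q * suc q ^ s * count (confused (x ∷ xs))    ≡⟨ rotate (suc q) (suc q ^ s) _ ⟩
      suc q ^ s * (suc q * count (confused (x ∷ xs)))  ≤⟨ *-monoʳ-≤ (suc q ^ s) fewer ⟩
      suc q ^ s * (q * count (confused xs))            ≡⟨ exchange (suc q ^ s) q _ ⟩
      q * (suc q ^ s * count (confused xs))            ≤⟨ *-monoʳ-≤ q few ⟩
      q * (q ^ s * (m * m))                            ≡⟨ *-assoc q (q ^ s) (m * m) ⟨
      q * q ^ s * (m * m)                              ∎)
    where
    open ≤-Reasoning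
    rotate : ∀ a b c → a * b * c ≡ b * (a * c)
    rotate = solve-∀
    exchange : ∀ a b c → a * (b * c) ≡ b * (a * c)
    exchange = solve-∀

  confused-all : ∀ {s} (xs : Vec (Fin n) s) i j → i ≢ j → map (row i) xs ≡ map (row j) xs → T (confused xs (combine i j))
  confused-all [] i j i≢j _ = subst₂ (λ a b → T (not ⌊ a ≟ b ⌋))
    (sym (cong proj₁ (remQuot-combine i j))) (sym (cong proj₂ (remQuot-combine i j))) differ
    where
    differ : T (not ⌊ i ≟ j ⌋)
    differ with i ≟ j
    ... | yes i≡j = i≢j i≡j
    ... | no  _   = _
  confused-all (x ∷ xs) i j i≢j eq = Equivalence.from T-∧ (confused-all xs i j i≢j (∷-injectiveʳ eq) ,
    subst₂ (λ a b → T (not (row a x xor row b x)))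
      (sym (cong proj₁ (remQuot-combine i j))) (sym (cong proj₂ (remQuot-combine i j))) same)
    where
    same : T (not (row i x xor row j x))
    same with row i x | row j x | ∷-injectiveˡ eq
    ... | true  | true  | _ = _
    ... | false | false | _ = _

  -- After `s` columns fewer than one of the `m * m` ordered pairs can still be confused, so none
  -- is.
  separating-columns : ∀ s → q ^ s * (m * m) < suc q ^ s → ∃ λ (xs : Vec (Fin n) s) → Injective _≡_ _≡_ (λ i → map (row i) xs)
  separating-columns s gap with separate s
  ... | xs , few = xs , inj
    where
    inj : Injective _≡_ _≡_ (λ i → map (row i) xs)
    inj {i} {j} eq with i ≟ j
    ... | yes i≡j = i≡j
    ... | no  i≢j = ⊥-elim (<-irrefl refl (<-≤-trans gap (≤-trans
            (m≤m*n (suc q ^ s) (count (confused xs)) {{>-nonZero one}}) few)))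
      where
      one : 0 < count (confused xs)
      one = ≤-trans (bit-mono {true} λ _ → confused-all xs i j i≢j eq) (term≤sum (bit ∘ confused xs) (combine i j))

distance : (G : Graph) → Vertex G → Vertex G → ℕ
distance G u v = count (λ x → adj G u x xor adj G v x)

module _ (G : Graph) (D q : ℕ) (vc : VC≤ G D) where

  private
    size = separation-size q (suc D)
    a = proj₁ size
    s = proj₁ (proj₂ size)

  -- Pairwise far neighbourhoods stay distinct on `s` suitable columns. Their `2 ^ a` traces exceed
  -- the Sauer-Shelah bound, so `suc D` of these columns would be shattered.
  no-far-family : (u : Fin (2 ^ a) → Vertex G) → ¬ (∀ i j → i ≢ j → order G ≤ suc q * distance G (u i) (u j))
  no-far-family u far = <-irrefl refl (shattered-points G (λ j → lookup xs (ι j)) patterns vc)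
    where
    0<n : ∀ {n} → Fin n → 0 < n
    0<n zero    = s≤s z≤n
    0<n (suc _) = s≤s z≤n
    columns = separating-columns q (λ i → adj G (u i)) (0<n (u (encode {a} (λ _ → true)))) far s (proj₁ (proj₂ (proj₂ size)))
    xs = proj₁ columns
    trace : Fin (2 ^ a) → Vec Bool s
    trace i = map (adj G (u i)) xs
    IsTrace : Vec Bool s → Bool
    IsTrace x = ⌊ any? (λ i → ≡-dec _≟ᵇ_ (trace i) x) ⌋
    many : 2 ^ a ≤ countVec IsTrace
    many = injective⇒≤ {f = λ i → vecIndex IsTrace (trace i) (fromWitness (i , refl))}
      λ {i} {j} eq → proj₂ columns (vecIndex-injective IsTrace {trace i} {trace j} _ _ eq)
    shattered = sauer-shelah s (suc D) IsTrace (<-≤-trans (proj₂ (proj₂ (proj₂ size))) many)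
    ι = proj₁ shattered
    patterns : ∀ (B : Fin (suc D) → Bool) → ∃ λ v → ∀ j → adj G v (lookup xs (ι j)) ≡ B j
    patterns B =
      let x , isTrace , ok = proj₂ shattered B ; i , eq = toWitness isTrace in
      u i , λ j → trans (sym (lookup-map (ι j) (adj G (u i)) xs)) (trans (cong (λ x → lookup x (ι j)) eq) (ok j))

  Net : ℕ → Set
  Net m = ∃ λ k → k ≤ m × ∃ λ (u : Fin k → Vertex G) → ∀ v → ∃ λ i → suc q * distance G (u i) v < order G

  -- A far family is extended by any vertex far from all its members; when there is no such vertex,
  -- the family is a net.
  far-or-net : ∀ m → (∃ λ (u : Fin m → Vertex G) → ∀ i j → i ≢ j → order G ≤ suc q * distance G (u i) (u j)) ⊎ Net m
  far-or-net zero    = inj₁ ((λ ()) , λ ())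
  far-or-net (suc m) with far-or-net m
  ... | inj₂ (k , k≤m , net) = inj₂ (k , m≤n⇒m≤1+n k≤m , net)
  ... | inj₁ (u , far) with all? (λ v → any? (λ i → suc q * distance G (u i) v <? order G))
  ...   | yes near = inj₂ (m , n≤1+n m , u , near)
  ...   | no ¬near = inj₁ (u′ , far′)
    where
    new = ¬∀⟶∃¬ (order G) _ (λ v → any? (λ i → suc q * distance G (u i) v <? order G)) ¬near
    v = proj₁ new
    u′ : Fin (suc m) → Vertex G
    u′ zero    = v
    u′ (suc i) = u i
    distance-sym : ∀ x y → distance G x y ≡ distance G y x
    distance-sym x y = sum-cong-≗ λ z → cong bit (xor-comm (adj G x z) (adj G y z))
    v-far : ∀ i → order G ≤ suc q * distance G (u i) v
    v-far i = ≮⇒≥ λ near → proj₂ new (i , near)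
    far′ : ∀ i j → i ≢ j → order G ≤ suc q * distance G (u′ i) (u′ j)
    far′ zero    zero    ne = ⊥-elim (ne refl)
    far′ zero    (suc j) ne = subst (λ d → order G ≤ suc q * d) (distance-sym (u j) v) (v-far j)
    far′ (suc i) zero    ne = v-far i
    far′ (suc i) (suc j) ne = far i j (ne ∘ cong suc)

  twin-net : Net (2 ^ a)
  twin-net with far-or-net (2 ^ a)
  ... | inj₁ (u , far) = ⊥-elim (no-far-family u far)
  ... | inj₂ net       = net

-- An Erdős-Stone theorem inside a vertex set

Multipartite : (G : Graph) → (Vertex G → Bool) → ℕ → ℕ → Set
Multipartite G W j h = ∃ λ (κ : Fin j → Fin h → Vertex G) →
  (∀ i a → T (W (κ i a))) × (∀ i → Injective _≡_ _≡_ (κ i)) × (∀ i i′ a a′ → i ≢ i′ → Adj G (κ i a) (κ i′ a′))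

-- Bad vertices of `W` miss at least `L` vertices of some part, so `g L ≥ w L - j (L + h) c ≥ n L /
-- b - j h c`. As `L` exceeds `2 b j h` and `c ≤ n`, the last term is at most `n L / (2
-- b)`, leaving `g ≥ n / (2 b)`.
good-vertices : ∀ b j h c n w g {L} → L ≡ suc (2 * (b * j * h)) → c ≤ n → b * j * c + n ≤ b * w →
  w * L ≤ g * L + j * ((L + h) * c) → n ≤ 2 * b * g
good-vertices b j h c n w g {L} refl c≤n wide count≤ = *-cancelʳ-≤ n (2 * b * g) L
  (+-cancelʳ-≤ (n * L + 2 * (b * (w * L)) + 2 * b * j * c * L) _ _ (begin
    n * L + (n * L + 2 * (b * (w * L)) + 2 * b * j * c * L)
      ≡⟨ shape₁ b j c n w L ⟩
    2 * ((b * j * c + n) * L) + 2 * (b * (w * L))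
      ≤⟨ +-mono-≤ (*-monoʳ-≤ 2 (*-monoˡ-≤ L wide)) (*-monoʳ-≤ 2 (*-monoʳ-≤ b count≤)) ⟩
    2 * (b * w * L) + 2 * (b * (g * L + j * ((L + h) * c)))
      ≡⟨ shape₂ b j h c w g L ⟩
    (2 * b * g * L + 2 * (b * (w * L)) + 2 * b * j * c * L) + 2 * (b * j * h) * c
      ≤⟨ +-monoʳ-≤ _ (≤-trans (*-mono-≤ (n≤1+n (2 * (b * j * h))) c≤n) (≤-reflexive (*-comm L n))) ⟩
    (2 * b * g * L + 2 * (b * (w * L)) + 2 * b * j * c * L) + n * L
      ≡⟨ shape₃ (2 * b * g * L) (2 * (b * (w * L))) (2 * b * j * c * L) (n * L) ⟩
    2 * b * g * L + (n * L + 2 * (b * (w * L)) + 2 * b * j * c * L) ∎))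
  where
  open ≤-Reasoning
  shape₁ : ∀ b j c n w L → n * L + (n * L + 2 * (b * (w * L)) + 2 * b * j * c * L) ≡ 2 * ((b * j * c + n) * L) + 2 * (b * (w * L))
  shape₁ = solve-∀
  shape₂ : ∀ b j h c w g L → 2 * (b * w * L) + 2 * (b * (g * L + j * ((L + h) * c))) ≡
           (2 * b * g * L + 2 * (b * (w * L)) + 2 * b * j * c * L) + 2 * (b * j * h) * c
  shape₂ = solve-∀
  shape₃ : ∀ x y z u → (x + y + z) + u ≡ x + (u + y + z)
  shape₃ = solve-∀

count-not : ∀ {n} (p : Fin n → Bool) → count p + count (not ∘ p) ≡ n
count-not {n} p = trans (sym (∑-distrib-+ (bit ∘ p) (bit ∘ not ∘ p)))
  (trans (sum-cong-≗ λ i → one (p i)) (count-all n))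
  where
  one : ∀ b → bit b + bit (not b) ≡ 1
  one true  = refl
  one false = refl

-- A positive fraction of all vertices lies in `W` and has `h` neighbours in each large part. More
-- than `h` of them make the same choice of `h` neighbours everywhere; they become the new part and
-- the old parts shrink to that choice.
extend-multipartite : ∀ G W j b h c → c ≤ order G → (∀ v → count (not ∘ adj G v) ≤ c) →
  b * suc j * c + order G ≤ b * count W →
  (let h′ = suc (2 * (b * suc j * h)) + h) →
  2 * b * suc ((h′ ^ h) ^ suc j * suc h) ≤ order G → .{{NonZero b}} →
  Multipartite G W (suc j) h′ → Multipartite G W (suc (suc j)) h
extend-multipartite G W j b h c c≤n non≤ wide n-large (κ , κ-in , κ-inj , κ-adj) = κ′ , κ′-in , κ′-inj , κ′-adj
  where
  n = order G
  L = suc (2 * (b * suc j * h))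
  h′ = L + h
  Rich : Vertex G → Set
  Rich w = ∀ i → h ≤ count (λ a → adj G (κ i a) w)
  rich? : ∀ w → Dec (Rich w)
  rich? w = all? (λ i → h ≤? count (λ a → adj G (κ i a) w))
  good : Vertex G → Bool
  good w = W w ∧ ⌊ rich? w ⌋
  missing : Vertex G → ℕ
  missing w = sum (λ i → count (λ a → not (adj G (κ i a) w)))
  poor : ∀ w → ¬ Rich w → L ≤ missing w
  poor w ¬rich =
    let i , few = ¬∀⟶∃¬ (suc j) _ (λ i → h ≤? count (λ a → adj G (κ i a) w)) ¬rich in
    ≤-trans
      (+-cancelˡ-≤ h _ _ (≤-trans (≤-reflexive (trans (+-comm h L) (sym (count-not (λ a → adj G (κ i a) w)))))
        (+-monoˡ-≤ _ (<⇒≤ (≰⇒> few)))))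
      (term≤sum (λ i → count (λ a → not (adj G (κ i a) w))) i)
  pointwise : ∀ w → bit (W w) * L ≤ bit (good w) * L + missing w
  pointwise w with W w | rich? w
  ... | false | _         = z≤n
  ... | true  | yes _     = m≤m+n _ _
  ... | true  | no ¬rich  = ≤-trans (≤-reflexive (+-identityʳ L)) (poor w ¬rich)
  missing-total : sum missing ≤ suc j * (h′ * c)
  missing-total = begin
    sum (λ w → sum (λ i → count (λ a → not (adj G (κ i a) w))))  ≡⟨ ∑-comm (λ w i → count (λ a → not (adj G (κ i a) w))) ⟩
    sum (λ i → sum (λ w → count (λ a → not (adj G (κ i a) w))))  ≤⟨ sum-mono inner ⟩
    sum {suc j} (λ _ → h′ * c)                                   ≡⟨ sum-const (suc j) (h′ * c) ⟩
    suc j * (h′ * c)                                             ∎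
    where
    open ≤-Reasoning
    inner : ∀ i → sum (λ w → count (λ a → not (adj G (κ i a) w))) ≤ h′ * c
    inner i = begin
      sum (λ w → count (λ a → not (adj G (κ i a) w)))            ≡⟨ ∑-comm (λ w a → bit (not (adj G (κ i a) w))) ⟩
      sum (λ a → count (not ∘ adj G (κ i a)))                    ≤⟨ sum-mono (λ a → non≤ (κ i a)) ⟩
      sum {h′} (λ _ → c)                                         ≡⟨ sum-const h′ c ⟩
      h′ * c                                                     ∎
  weighed : count W * L ≤ count good * L + suc j * (h′ * c)
  weighed = begin
    count W * L                                       ≡⟨ sum-*ʳ (bit ∘ W) L ⟨
    sum (λ w → bit (W w) * L)                         ≤⟨ sum-mono pointwise ⟩
    sum (λ w → bit (good w) * L + missing w)          ≡⟨ ∑-distrib-+ (λ w → bit (good w) * L) missing ⟩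
    sum (λ w → bit (good w) * L) + sum missing        ≤⟨ +-mono-≤ (≤-reflexive (sum-*ʳ (bit ∘ good) L)) missing-total ⟩
    count good * L + suc j * (h′ * c)                 ∎
    where open ≤-Reasoning
  many-good : suc ((h′ ^ h) ^ suc j * suc h) ≤ count good
  many-good = *-cancelˡ-≤ (2 * b) {{m*n≢0 2 b}} (≤-trans n-large (good-vertices b (suc j) h c n (count W) (count good) {L} refl c≤n wide weighed))
  enum = enumerate good
  e = proj₁ enum
  e-inj = proj₁ (proj₂ enum)
  e-in : ∀ t → T (W (e t)) × Rich (e t)
  e-in t = let w , r = Equivalence.to (T-∧ {W (e t)}) (proj₁ (proj₂ (proj₂ enum)) t) in w , toWitness r
  choice = λ t i → count≥⇒injection (λ a → adj G (κ i a) (e t)) (proj₂ (e-in t) i)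
  box : Fin (count good) → Fin ((h′ ^ h) ^ suc j)
  box t = funToFin (λ i → funToFin (proj₁ (choice t i)))
  full = pigeonholes (λ _ → true) box (suc h) (subst ((h′ ^ h) ^ suc j * suc h <_) (sym (count-all (count good))) many-good)
  g = proj₁ (proj₂ full)
  g-inj = proj₁ (proj₂ (proj₂ full))
  same : ∀ t i a → proj₁ (choice (g t) i) a ≡ proj₁ (choice (g zero) i) a
  same t i a = begin
    proj₁ (choice (g t) i) a                                                     ≡⟨ finToFun-funToFin (proj₁ (choice (g t) i)) a ⟨
    finToFun {h′} {h} (funToFin (proj₁ (choice (g t) i))) a                      ≡⟨ cong (λ x → finToFun {h′} {h} x a) (finToFun-funToFin (λ i → funToFin (proj₁ (choice (g t) i))) i) ⟨
    finToFun {h′} {h} (finToFun {h′ ^ h} {suc j} (box (g t)) i) a                ≡⟨ cong (λ x → finToFun {h′} {h} (finToFun {h′ ^ h} {suc j} x i) a) boxes ⟩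
    finToFun {h′} {h} (finToFun {h′ ^ h} {suc j} (box (g zero)) i) a             ≡⟨ cong (λ x → finToFun {h′} {h} x a) (finToFun-funToFin (λ i → funToFin (proj₁ (choice (g zero) i))) i) ⟩
    finToFun {h′} {h} (funToFin (proj₁ (choice (g zero) i))) a                   ≡⟨ finToFun-funToFin (proj₁ (choice (g zero) i)) a ⟩
    proj₁ (choice (g zero) i) a                                                  ∎
    where
    open ≡-Reasoning
    boxes : box (g t) ≡ box (g zero)
    boxes = trans (proj₂ (proj₂ (proj₂ (proj₂ full)) t)) (sym (proj₂ (proj₂ (proj₂ (proj₂ full)) zero)))
  κ′ : Fin (suc (suc j)) → Fin h → Vertex G
  κ′ zero    a = e (g (inject₁ a))
  κ′ (suc i) a = κ i (proj₁ (choice (g zero) i) a)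
  κ′-in : ∀ i a → T (W (κ′ i a))
  κ′-in zero    a = proj₁ (e-in (g (inject₁ a)))
  κ′-in (suc i) a = κ-in i _
  κ′-inj : ∀ i → Injective _≡_ _≡_ (κ′ i)
  κ′-inj zero    eq = inject₁-injective (g-inj (e-inj eq))
  κ′-inj (suc i) eq = proj₁ (proj₂ (choice (g zero) i)) (κ-inj i eq)
  cross : ∀ i a a′ → Adj G (κ′ (suc i) a) (κ′ zero a′)
  cross i a a′ = subst (λ x → Adj G (κ i x) (e (g (inject₁ a′)))) (same (inject₁ a′) i a)
    (proj₂ (proj₂ (choice (g (inject₁ a′)) i)) a)
  κ′-adj : ∀ i i′ a a′ → i ≢ i′ → Adj G (κ′ i a) (κ′ i′ a′)
  κ′-adj zero    zero     a a′ ne = ⊥-elim (ne refl)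
  κ′-adj zero    (suc i′) a a′ ne = symm G (cross i′ a′ a)
  κ′-adj (suc i) zero     a a′ ne = cross i a a′
  κ′-adj (suc i) (suc i′) a a′ ne = κ-adj i i′ _ _ (ne ∘ cong suc)

-- Every vertex misses at most `c` vertices, itself included, and `W` exceeds `j * c` by a fraction
-- `1/b` of all vertices; that leaves room for `suc j` parts. The induction pays for each new part
-- by asking for larger parts one level down.
erdős-stone : ∀ j h b → .{{NonZero b}} → ∃ λ n₀ → ∀ G W c → n₀ ≤ order G → c ≤ order G →
  (∀ v → count (not ∘ adj G v) ≤ c) → b * j * c + order G ≤ b * count W → Multipartite G W (suc j) h
erdős-stone zero h b = b * h , λ G W c n-large _ _ wide →
  let g , g-inj , g-in = count≥⇒injection W (*-cancelˡ-≤ b (≤-trans n-large (≤-trans (m≤n+m _ (b * 0 * c)) wide))) in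
  (λ _ → g) , (λ _ → g-in) , (λ _ → g-inj) , λ { zero zero _ _ ne → ⊥-elim (ne refl) }
erdős-stone (suc j) h b =
  let h′ = suc (2 * (b * suc j * h)) + h
      n₁ , rec = erdős-stone j h′ b
      n₂ = 2 * b * suc ((h′ ^ h) ^ suc j * suc h)
  in n₁ ⊔ n₂ , λ G W c n-large c≤n non≤ wide →
  extend-multipartite G W j b h c c≤n non≤ wide (≤-trans (m≤n⊔m n₁ n₂) n-large)
    (rec G W c (≤-trans (m≤m⊔n n₁ n₂) n-large) c≤n non≤
      (≤-trans (+-monoˡ-≤ (order G) (*-monoˡ-≤ c (*-monoʳ-≤ b (n≤1+n j)))) wide))

-- Near-twin classes and bounded chromatic number

-- With `γ = p / den`, integrality in `j * den < suc j * p` gives `γ - j (1 - γ) ≥ 1 / den`. Passing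
-- from the degree to `w` loses at most `h n / s < n / (2 den)` when `n > 0`, so `w - j c` is still
-- at least `n / (2 den)`.
common-wide : ∀ den j p h c n deg w {s} → s ≡ suc (2 * den * h) → c * den + p * n ≤ den * n → p * n ≤ den * deg →
  s * deg ≤ s * w + h * n → j * den < suc j * p → 2 * den * j * c + n ≤ 2 * den * w
common-wide den j p h c n deg w {s} refl c≤ deg≥ loss θ = *-cancelˡ-≤ s
  (+-cancelʳ-≤ (2 * s * j * p * n + s * n + 2 * s * n * j * den + 2 * s * p * n + 2 * s * den * deg + 2 * den * h * n) _ _ (begin
    s * (2 * den * j * c + n) + (2 * s * j * p * n + s * n + 2 * s * n * j * den + 2 * s * p * n + 2 * s * den * deg + 2 * den * h * n)
      ≡⟨ shape₁ den j p h c n deg s ⟩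
    2 * s * j * (c * den + p * n) + 2 * s * (p * n) + 2 * den * (s * deg) + 2 * s * n * suc (j * den) + (2 * den * h) * n
      ≤⟨ +-mono-≤ (+-mono-≤ (+-mono-≤ (+-mono-≤ (*-monoʳ-≤ (2 * s * j) c≤) (*-monoʳ-≤ (2 * s) deg≥))
           (*-monoʳ-≤ (2 * den) loss)) (*-monoʳ-≤ (2 * s * n) θ)) (*-monoˡ-≤ n (n≤1+n (2 * den * h))) ⟩
    2 * s * j * (den * n) + 2 * s * (den * deg) + 2 * den * (s * w + h * n) + 2 * s * n * (suc j * p) + s * n
      ≡⟨ shape₂ den j p h n deg w s ⟩
    s * (2 * den * w) + (2 * s * j * p * n + s * n + 2 * s * n * j * den + 2 * s * p * n + 2 * s * den * deg + 2 * den * h * n) ∎))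
  where
  open ≤-Reasoning
  shape₁ : ∀ den j p h c n deg s →
    s * (2 * den * j * c + n) + (2 * s * j * p * n + s * n + 2 * s * n * j * den + 2 * s * p * n + 2 * s * den * deg + 2 * den * h * n) ≡
    2 * s * j * (c * den + p * n) + 2 * s * (p * n) + 2 * den * (s * deg) + 2 * s * n * suc (j * den) + (2 * den * h) * n
  shape₁ = solve-∀
  shape₂ : ∀ den j p h n deg w s →
    2 * s * j * (den * n) + 2 * s * (den * deg) + 2 * den * (s * w + h * n) + 2 * s * n * (suc j * p) + s * n ≡
    s * (2 * den * w) + (2 * s * j * p * n + s * n + 2 * s * n * j * den + 2 * s * p * n + 2 * s * den * deg + 2 * den * h * n)
  shape₂ = solve-∀

induced : (G : Graph) {k : ℕ} → (Fin k → Vertex G) → Graph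
induced G e = graphOn (Adj G) (λ a b → T? (adj G a b)) (symm G) (irrefl G) e

module _ (H : Graph) (j p den : ℕ) .{{_ : NonZero den}} (θ : j * den < suc j * p) where

  private
    h = order H
    Q = 2 * den * h

    instance
      2den≢0 : NonZero (2 * den)
      2den≢0 = m*n≢0 2 den

    es = erdős-stone j h (2 * den)

  n₀ : ℕ
  n₀ = proj₁ es

  Dense : Graph → Set
  Dense G = ∀ v → p * order G ≤ den * degree G v

  -- Vertices with nearly the same neighbourhoods have a common neighbourhood so large that it
  -- contains a complete (1 + j)-partite graph, hence every join over G[A] that contains H lifts to G.
  twins-join-free : ∀ G → n₀ ≤ order G → Free H G → Dense G → ∀ u {k} (e : Fin k → Vertex G) → Injective _≡_ _≡_ e →
    (∀ i → suc Q * distance G u (e i) < order G) → Free H (join (suc j) (induced G e))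
  twins-join-free G n-large free dense u {k} e e-inj near (g , g-inj , g-hom) = free (f , f-inj , λ {x} {y} → f-hom x y)
    where
    n = order G
    deg = count (adj G u)
    part : Vertex H → Fin (suc (suc j))
    part x = proj₁ (remQuot {suc (suc j)} k (g x))
    place : Vertex H → Fin k
    place x = proj₂ (remQuot {suc (suc j)} k (g x))
    linked : ∀ {x y} → Adj H x y → part x ≡ part y → part x ≡ zero × Adj G (e (place x)) (e (place y))
    linked {x} {y} xy eq = map₂ decide⁻ (join-linked (suc j) (induced G e) {g x} {g y} (g-hom xy) eq)
    Common : Vertex G → Set
    Common w = ∀ x → Adj G (e (place x)) w
    common? : ∀ w → Dec (Common w)
    common? w = all? (λ x → T? (adj G (e (place x)) w))
    W : Vertex G → Bool
    W w = ⌊ common? w ⌋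
    -- A neighbour of `u` outside `W` is missed by some near-twin of `u`, hence counted in the
    -- distance to it.
    pointwise : ∀ w → bit (adj G u w) ≤ bit (W w) + sum (λ x → bit (adj G u w xor adj G (e (place x)) w))
    pointwise w with common? w
    ... | yes _ = ≤-trans (bit-mono {b = true} _) (m≤m+n 1 _)
    ... | no ¬c =
      let x , ¬xw = ¬∀⟶∃¬ h _ (λ x → T? (adj G (e (place x)) w)) ¬c in
      ≤-trans (differ (adj G u w) (adj G (e (place x)) w) ¬xw) (term≤sum (λ x → bit (adj G u w xor adj G (e (place x)) w)) x)
      where
      differ : ∀ a b → ¬ T b → bit a ≤ bit (a xor b)
      differ a     true  ¬b = ⊥-elim (¬b _)
      differ true  false ¬b = s≤s z≤n
      differ false false ¬b = z≤n
    loss : suc Q * deg ≤ suc Q * count W + h * n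
    loss = begin
      suc Q * deg                                                    ≤⟨ *-monoʳ-≤ (suc Q) (sum-mono pointwise) ⟩
      suc Q * sum (λ w → bit (W w) + sum (λ x → apart w x))          ≡⟨ cong (suc Q *_) (∑-distrib-+ (bit ∘ W) (λ w → sum (apart w))) ⟩
      suc Q * (count W + sum (λ w → sum (λ x → apart w x)))          ≡⟨ *-distribˡ-+ (suc Q) (count W) _ ⟩
      suc Q * count W + suc Q * sum (λ w → sum (λ x → apart w x))    ≡⟨ cong (λ s → suc Q * count W + suc Q * s) (∑-comm apart) ⟩
      suc Q * count W + suc Q * sum (λ x → distance G u (e (place x))) ≡⟨ cong (suc Q * count W +_) (*-comm (suc Q) (sum (λ x → distance G u (e (place x))))) ⟩
      suc Q * count W + sum (λ x → distance G u (e (place x))) * suc Q ≡⟨ cong (suc Q * count W +_) (sum-*ʳ (λ x → distance G u (e (place x))) (suc Q)) ⟨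
      suc Q * count W + sum (λ x → distance G u (e (place x)) * suc Q) ≤⟨ +-monoʳ-≤ (suc Q * count W) (sum-mono λ x → ≤-trans (≤-reflexive (*-comm _ (suc Q))) (<⇒≤ (near (place x)))) ⟩
      suc Q * count W + sum {h} (λ _ → n)                            ≡⟨ cong (suc Q * count W +_) (sum-const h n) ⟩
      suc Q * count W + h * n                                        ∎
      where
      open ≤-Reasoning
      apart : Vertex G → Vertex H → ℕ
      apart w x = bit (adj G u w xor adj G (e (place x)) w)
    deg≥ : ∀ v → p * n ≤ den * count (adj G v)
    deg≥ v = subst (λ d → p * n ≤ den * d) (∣tabulate∣ (adj G v)) (dense v)
    -- The largest number of non-neighbours that the minimum degree permits, rounded down.
    c = (den * n ∸ p * n) ÷ den
    non+ : ∀ v → count (not ∘ adj G v) * den + p * n ≤ den * n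
    non+ v = begin
      count (not ∘ adj G v) * den + p * n                        ≤⟨ +-monoʳ-≤ _ (deg≥ v) ⟩
      count (not ∘ adj G v) * den + den * count (adj G v)        ≡⟨ collect (count (not ∘ adj G v)) den (count (adj G v)) ⟩
      den * (count (adj G v) + count (not ∘ adj G v))            ≡⟨ cong (den *_) (count-not (adj G v)) ⟩
      den * n                                                    ∎
      where
      open ≤-Reasoning
      collect : ∀ a d b → a * d + d * b ≡ d * (b + a)
      collect = solve-∀
    non≤ : ∀ v → count (not ∘ adj G v) ≤ c
    non≤ v = subst (_≤ c) (m*n/n≡m (count (not ∘ adj G v)) den) (/-monoˡ-≤ den (m+n≤o⇒m≤o∸n _ (non+ v)))
    c+ : c * den + p * n ≤ den * n
    c+ = ≤-trans (+-monoˡ-≤ (p * n) (m/n*n≤m (den * n ∸ p * n) den))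
      (≤-reflexive (m∸n+n≡m (≤-trans (m≤n+m (p * n) _) (non+ u))))
    c≤n : c ≤ n
    c≤n = *-cancelʳ-≤ c n den (≤-trans (m≤m+n _ (p * n)) (≤-trans c+ (≤-reflexive (*-comm den n))))
    K : Multipartite G W (suc j) h
    K = proj₂ es G W c n-large c≤n non≤ (common-wide den j p h c n deg (count W) {suc Q} refl c+ (deg≥ u) loss θ)
    κ = proj₁ K
    κ-common : ∀ i a x → Adj G (e (place x)) (κ i a)
    κ-common i a = toWitness (proj₁ (proj₂ K) i a)
    κ-inj = proj₁ (proj₂ (proj₂ K))
    κ-adj = proj₂ (proj₂ (proj₂ K))
    -- Vertices of `H` in part `zero` keep their place among the near-twins; each other part has one
    -- place reserved per vertex of `H`.
    put : Fin (suc (suc j)) → Vertex H → Vertex G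
    put zero    x = e (place x)
    put (suc i) x = κ i x
    f : Vertex H → Vertex G
    f x = put (part x) x
    put-adj : ∀ i i′ x y → i ≢ i′ → Adj G (put i x) (put i′ y)
    put-adj zero    zero     x y ne = ⊥-elim (ne refl)
    put-adj zero    (suc i′) x y ne = κ-common i′ y x
    put-adj (suc i) zero     x y ne = symm G (κ-common i x y)
    put-adj (suc i) (suc i′) x y ne = κ-adj i i′ x y (ne ∘ cong suc)
    put-inj : ∀ i x y → part x ≡ i → part y ≡ i → put i x ≡ put i y → x ≡ y
    put-inj zero    x y px py eq = g-inj (trans (sym (combine-remQuot {suc (suc j)} k (g x)))
      (trans (cong₂ combine (trans px (sym py)) (e-inj eq)) (combine-remQuot {suc (suc j)} k (g y))))
    put-inj (suc i) x y px py eq = κ-inj i eq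
    f-inj : Injective _≡_ _≡_ f
    f-inj {x} {y} eq with part x ≟ part y
    ... | yes same = put-inj (part x) x y refl (sym same) (trans eq (cong (λ i → put i y) (sym same)))
    ... | no  diff = ⊥-elim (irrefl G (subst (Adj G (f x)) (sym eq) (put-adj (part x) (part y) x y diff)))
    f-hom : ∀ x y → Adj H x y → Adj G (f x) (f y)
    f-hom x y xy with part x ≟ part y
    ... | no  diff = put-adj (part x) (part y) x y diff
    ... | yes same =
      let zero₁ , e₁ = linked xy same in
      subst₂ (λ i i′ → Adj G (put i x) (put i′ y)) (sym zero₁) (trans (sym zero₁) same) e₁

  module _ (D C₁ : ℕ) (vc≤ : ∀ G → MaximalFree H G → Dense G → VC≤ G D)
           (χ≤ : ∀ G → Free H G → (∀ v → suc j * order G ≤ degree G v * suc (suc j)) → Colourable G C₁) where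

    private
      m = 2 ^ proj₁ (separation-size Q (suc D))

    -- Each near-twin class is coloured through its join with independent sets, whose minimum degree
    -- ratio is large enough for `χ≤`. The at most `m` classes get disjoint palettes.
    maximal-colourable : ∀ G → n₀ ≤ order G → MaximalFree H G → Dense G → Colourable G (m * C₁)
    maximal-colourable G n-large max dense = colour , λ {x} {y} → proper x y
      where
      net = twin-net G D Q (vc≤ G max dense)
      k = proj₁ net
      k≤m = proj₁ (proj₂ net)
      u = proj₁ (proj₂ (proj₂ net))
      cl : Vertex G → Fin k
      cl v = proj₁ (proj₂ (proj₂ (proj₂ net)) v)
      near : ∀ v → suc Q * distance G (u (cl v)) v < order G
      near v = proj₂ (proj₂ (proj₂ (proj₂ net)) v)
      enum = λ i → enumerate (λ v → ⌊ cl v ≟ i ⌋)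
      e = λ i → proj₁ (enum i)
      part-colourable : ∀ i → Colourable (join (suc j) (induced G (e i))) C₁
      part-colourable i = χ≤ (join (suc j) (induced G (e i)))
        (twins-join-free G n-large (proj₁ max) dense (u i) (e i) (proj₁ (proj₂ (enum i)))
          (λ t → subst (λ l → suc Q * distance G (u l) (e i t) < order G) (toWitness (proj₁ (proj₂ (proj₂ (enum i))) t)) (near (e i t))))
        λ v → let s = order (induced G (e i)) in
          ≤-trans (≤-reflexive (trans (cong (suc j *_) (*-comm (suc (suc j)) s)) (sym (*-assoc (suc j) s (suc (suc j))))))
            (*-monoˡ-≤ (suc (suc j)) (join-degree (suc j) (induced G (e i)) v))
      index : ∀ i v → cl v ≡ i → ∃ λ t → e i t ≡ v
      index i v eq = proj₂ (proj₂ (proj₂ (enum i))) v (fromWitness eq)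
      shade : ∀ i v → cl v ≡ i → Fin C₁
      shade i v eq = proj₁ (part-colourable i) (combine {suc (suc j)} zero (proj₁ (index i v eq)))
      colour : Vertex G → Fin (m * C₁)
      colour v = combine (inject≤ (cl v) k≤m) (shade (cl v) v refl)
      -- The class indices are kept as variables so that their equality can be matched.
      differ : ∀ i i′ x y (px : cl x ≡ i) (py : cl y ≡ i′) → i ≡ i′ → Adj G x y → shade i x px ≢ shade i′ y py
      differ i i′ x y px py refl xy = proj₂ (part-colourable i) (join-adj (suc j) (induced G (e i)) {zero} {zero}
        λ _ → refl , decide⁺ (subst₂ (Adj G) (sym (proj₂ (index i x px))) (sym (proj₂ (index i y py))) xy))
      proper : ∀ x y → Adj G x y → colour x ≢ colour y
      proper x y xy eq =
        let cl≡ , shade≡ = combine-injective (inject≤ (cl x) k≤m) _ (inject≤ (cl y) k≤m) _ eq in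
        differ (cl x) (cl y) x y refl refl (inject≤-injective k≤m k≤m _ _ cl≡) xy shade≡

Colourable-mono : ∀ G {k l} → k ≤ l → Colourable G k → Colourable G l
Colourable-mono G k≤l (c , proper) = (λ v → inject≤ (c v) k≤l) , λ e eq → proper e (inject≤-injective k≤l k≤l _ _ eq)

-- Exhaustive search; decidability yields a least number of colours and removes the double negation
-- left by `maximal-extension`.
colourable? : ∀ G k → Dec (Colourable G k)
colourable? G k = map′ to from (any? λ (c : Fin (k ^ order G)) → all? λ u → all? λ v →
  T? (adj G u v) →-dec ¬? (finToFun {k} {order G} c u ≟ finToFun c v))
  where
  to : (∃ λ (c : Fin (k ^ order G)) → ∀ u v → Adj G u v → finToFun {k} {order G} c u ≢ finToFun c v) → Colourable G k
  to (c , proper) = finToFun c , proper _ _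
  from : Colourable G k → ∃ λ (c : Fin (k ^ order G)) → ∀ u v → Adj G u v → finToFun {k} {order G} c u ≢ finToFun c v
  from (c , proper) = funToFin c , λ u v e eq →
    proper e (trans (sym (finToFun-funToFin c u)) (trans eq (finToFun-funToFin c v)))

Colourable⇒ChromaticNumber≤ : ∀ G C → Colourable G C → ChromaticNumber≤ G C
Colourable⇒ChromaticNumber≤ G zero    col = 0 , (col , λ _ _ → z≤n) , z≤n
Colourable⇒ChromaticNumber≤ G (suc C) col with colourable? G C
... | yes col′ = let k , χ , k≤C = Colourable⇒ChromaticNumber≤ G C col′ in k , χ , m≤n⇒m≤1+n k≤C
... | no ¬col′ = suc C , (col , λ j colⱼ → ≰⇒> λ j≤C → ¬col′ (Colourable-mono G j≤C colⱼ)) , ≤-refl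

-- Graphs too small for the Erdős-Stone argument get one colour per vertex; the others inherit a
-- colouring from a maximal H-free extension.
chromatic-bound : ∀ H j p den → .{{_ : NonZero den}} → j * den < suc j * p → ∀ D C₁ →
  (∀ G → MaximalFree H G → (∀ v → p * order G ≤ den * degree G v) → VC≤ G D) →
  (∀ G → Free H G → (∀ v → suc j * order G ≤ degree G v * suc (suc j)) → Colourable G C₁) →
  ∃ λ C → ∀ G → Free H G → (∀ v → p * order G ≤ den * degree G v) → ChromaticNumber≤ G C
chromatic-bound H j p den θ D C₁ vc≤ χ≤ = C , λ G free dense → Colourable⇒ChromaticNumber≤ G C (colourable G free dense)
  where
  small = n₀ H j p den θ
  large = 2 ^ proj₁ (separation-size (2 * den * order H) (suc D)) * C₁
  C = small + large
  colourable : ∀ G → Free H G → (∀ v → p * order G ≤ den * degree G v) → Colourable G C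
  colourable G free dense with small ≤? order G
  ... | no  n<  = Colourable-mono G (≤-trans (<⇒≤ (≰⇒> n<)) (m≤m+n small large)) (id , λ {u} {v} e eq → irrefl G (subst (Adj G u) (sym eq) e))
  ... | yes n≥ = decidable-stable (colourable? G C) λ ¬col → maximal-extension H G free λ (E , G⊑E , max) →
    let c , proper = maximal-colourable H j p den θ D C₁ vc≤ χ≤ (graph E) n≥ max
                       (λ v → ≤-trans (dense v) (*-monoʳ-≤ den (degree-mono {E = edges G} {E} G⊑E v)))
    in ¬col (Colourable-mono G (m≤n+m large small) (c , λ e → proper (G⊑E _ _ e)))

open import Data.Integer using (+_; -[1+_])
import Data.Integer as ℤ
import Data.Integer.Properties as ℤ
open import Data.Rational using (ℚ; 0ℚ; mkℚ; _/_)
import Data.Rational as ℚ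
import Data.Rational.Properties as ℚ
open import Data.Rational.Unnormalised using (mkℚᵘ; *≤*; *<*)
import Data.Rational.Unnormalised as ℚᵘ
import Data.Rational.Unnormalised.Properties as ℚᵘ

-- Rational bounds and comparison of the thresholds

toℚᵘ-/ : ∀ a b → ℚ.toℚᵘ (+ a / suc b) ℚᵘ.≃ mkℚᵘ (+ a) b
toℚᵘ-/ a b = ℚ.toℚᵘ-fromℚᵘ (mkℚᵘ (+ a) b)

/-mono-< : ∀ a b c d .{{_ : NonZero b}} .{{_ : NonZero d}} → a * d < c * b → + a / b ℚ.< + c / d
/-mono-< a (suc b) c (suc d) ad<cb = ℚ.toℚᵘ-cancel-<
  (ℚᵘ.<-respˡ-≃ (ℚᵘ.≃-sym (toℚᵘ-/ a b)) (ℚᵘ.<-respʳ-≃ (ℚᵘ.≃-sym (toℚᵘ-/ c d))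
    (*<* (subst₂ ℤ._<_ (ℤ.pos-* a (suc d)) (ℤ.pos-* c (suc b)) (ℤ.+<+ ad<cb)))))

/-cancel-< : ∀ a b c d .{{_ : NonZero b}} .{{_ : NonZero d}} → + a / b ℚ.< + c / d → a * d < c * b
/-cancel-< a (suc b) c (suc d) lt = ℤ.drop‿+<+ (subst₂ ℤ._<_ (sym (ℤ.pos-* a (suc d))) (sym (ℤ.pos-* c (suc b)))
  (ℚᵘ.drop-*<* (ℚᵘ.<-respˡ-≃ (toℚᵘ-/ a b) (ℚᵘ.<-respʳ-≃ (toℚᵘ-/ c d) (ℚ.toℚᵘ-mono-< lt)))))

toℚᵘ-/* : ∀ a b n → ℚ.toℚᵘ (+ a / suc b ℚ.* fromℕ n) ℚᵘ.≃ mkℚᵘ (+ a) b ℚᵘ.* mkℚᵘ (+ n) 0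
toℚᵘ-/* a b n = ℚᵘ.≃-trans (ℚ.toℚᵘ-homo-* (+ a / suc b) (fromℕ n)) (ℚᵘ.*-congʳ {mkℚᵘ (+ n) 0} (toℚᵘ-/ a b))

private
  cross : ∀ a b n m → (+ a ℤ.* + n) ℤ.* + 1 ≡ + (a * n) × + m ℤ.* + (suc b * 1) ≡ + (m * suc b)
  cross a b n m = trans (ℤ.*-identityʳ _) (sym (ℤ.pos-* a n)) ,
    trans (sym (ℤ.pos-* m (suc b * 1))) (cong (λ x → + (m * x)) (*-identityʳ (suc b)))

/*≤⁺ : ∀ a b n m .{{_ : NonZero b}} → a * n ≤ m * b → + a / b ℚ.* fromℕ n ℚ.≤ fromℕ m
/*≤⁺ a (suc b) n m le = ℚ.toℚᵘ-cancel-≤ (ℚᵘ.≤-respˡ-≃ (ℚᵘ.≃-sym (toℚᵘ-/* a b n))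
  (*≤* (subst₂ ℤ._≤_ (sym (proj₁ (cross a b n m))) (sym (proj₂ (cross a b n m))) (ℤ.+≤+ le))))

/*≤⁻ : ∀ a b n m .{{_ : NonZero b}} → + a / b ℚ.* fromℕ n ℚ.≤ fromℕ m → a * n ≤ m * b
/*≤⁻ a (suc b) n m le = ℤ.drop‿+≤+ (subst₂ ℤ._≤_ (proj₁ (cross a b n m)) (proj₂ (cross a b n m))
  (ℚᵘ.drop-*≤* (ℚᵘ.≤-respˡ-≃ (toℚᵘ-/* a b n) (ℚ.toℚᵘ-mono-≤ le))))

MinDegree≥⁺ : ∀ G (γ : ℝ 0ℓ) {q} a b .{{_ : NonZero b}} → Upper γ q → q ℚ.≤ + a / b →
              (∀ v → a * order G ≤ degree G v * b) → MinDegree≥ G γ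
MinDegree≥⁺ G γ {q} a b γ<q q≤a/b deg v d<p = q , γ<q ,
  ℚ.≤-<-trans (ℚ.≤-trans (ℚ.*-monoʳ-≤-nonNeg (fromℕ (order G)) q≤a/b) (/*≤⁺ a b (order G) (degree G v) (deg v))) d<p

-- If the degree were smaller, the product `+ a / b ℚ.* fromℕ (order G)` would lie in the open upper
-- cut of the left side, hence strictly above itself.
MinDegree≥⁻ : ∀ G a b .{{_ : NonZero b}} → MinDegree≥ G (fromℚ (+ a / b)) → ∀ v → a * order G ≤ degree G v * b
MinDegree≥⁻ G a b δ≥ v = /*≤⁻ a b (order G) (degree G v) (ℚ.≮⇒≥ λ d<an →
  let q , a/b<q , qn< = δ≥ v d<an in
  ℚ.<-irrefl refl (ℚ.≤-<-trans (ℚ.*-monoʳ-≤-nonNeg (fromℕ (order G)) (ℚ.<⇒≤ a/b<q)) qn<))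

positive-fraction : ∀ q → 0ℚ ℚ.< q → ∃ λ p → ∃ λ d → q ≡ + p / suc d
positive-fraction q@(mkℚ (+ p) d _)    _   = p , d , sym (ℚ.fromℚᵘ-toℚᵘ q)
positive-fraction q@(mkℚ -[1+ _ ] _ _) 0<q = ⊥-elim (ℚ.<-asym 0<q (ℚ.negative⁻¹ q))

below-both : ∀ {x y z} → x ℚ.< z → y ℚ.< z → ∃ λ m → x ℚ.< m × y ℚ.< m × m ℚ.< z
below-both {x} {y} x<z y<z with ℚ.≤-total x y
... | inj₁ x≤y = let m , y<m , m<z = ℚ.<-dense y<z in m , ℚ.≤-<-trans x≤y y<m , y<m , m<z
... | inj₂ y≤x = let m , x<m , m<z = ℚ.<-dense x<z in m , x<m , ℚ.≤-<-trans y≤x x<m , m<z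

δVC-above : ∀ H k → HasChromaticNumber H (3 + k) → ∀ {q} → Upper (δVC H) q → + k / suc k ℚ.< q
δVC-above H k (col , least) {q} (γ , (_ , D , vc) , γ<q) = ℚ.≰⇒> λ q≤ →
  no-VC-bound H k D col (λ col′ → <-irrefl refl (least (2 + k) col′))
    λ G max deg → vc G max (MinDegree≥⁺ G γ k (suc k) γ<q q≤ deg)

-- `t₁<t` leaves room for a ratio `x` at which the Erdős-Stone argument applies, and `t<t₂` puts the
-- ratio of the joins above `δχ H`.
δχ≈⇒δVC-above : ∀ H k t → + k / suc k ℚ.< t → t ℚ.< + suc k / suc (suc k) → δχ H ≈ᴿ fromℚ t →
  ∀ {q} → Upper (δVC H) q → t ℚ.< q
δχ≈⇒δVC-above H k t t₁<t t<t₂ (δχ≤t , t≤δχ) {q} (γ , (_ , D , vc) , γ<q) = ℚ.≰⇒> λ q≤t →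
  -- Roundedness moves the bound strictly below `t`, even if `q` equals `t`.
  let q′ , q′<q , γ<q′ = rounded γ γ<q
      x , t₁<x , q′<x , x<t = below-both t₁<t (ℚ.<-≤-trans q′<q q≤t)
      0<x = ℚ.≤-<-trans (ℚ.nonNegative⁻¹ (+ k / suc k) {{ℚ.normalize-nonNeg k (suc k)}}) t₁<x
      p , d , x≡ = positive-fraction x 0<x
      -- Boundedness at `x` puts only rationals above `x` into the cut of `δχ H`, so a `y` strictly
      -- between `x` and `t` gives the contradiction.
      y , x<y , y<t = ℚ.<-dense x<t
      γ₁ , (_ , C₁ , χ₁) , γ₁<t₂ = δχ≤t t<t₂
      C , bound = chromatic-bound H k p (suc d)
        (subst (k * suc d <_) (*-comm p (suc k)) (/-cancel-< k (suc k) p (suc d) (subst (+ k / suc k ℚ.<_) x≡ t₁<x)))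
        D C₁
        (λ G max dense → vc G max (MinDegree≥⁺ G γ p (suc d) γ<q′ (ℚ.<⇒≤ (subst (q′ ℚ.<_) x≡ q′<x))
          λ v → subst (p * order G ≤_) (*-comm (suc d) _) (dense v)))
        (λ G free deg →
          let _ , (col , _) , k≤C₁ = χ₁ G free (MinDegree≥⁺ G γ₁ (suc k) (suc (suc k)) γ₁<t₂ ℚ.≤-refl deg)
          in Colourable-mono G k≤C₁ col)
      bounded-at-x : ChromaticBounded H (fromℚ x)
      bounded-at-x = (x , 0<x , λ x<p → x<p) , C , λ G free δ≥ → bound G free λ v →
        subst (p * order G ≤_) (*-comm _ (suc d)) (MinDegree≥⁻ G p (suc d) (subst (λ x → MinDegree≥ G (fromℚ x)) x≡ δ≥) v)
  in ℚ.<-asym y<t (t≤δχ (fromℚ x , bounded-at-x , x<y))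

corollary1p10 : (H : Graph) (r : ℕ) (3≤r : 3 ≤ r) → HasChromaticNumber H r →
    δχ H ≈ᴿ fromℚ (_/_ (+ (r ∸ 3)) (r ∸ 2) {{r∸2-nonZero 3≤r}}) ⊎ δχ H ≈ᴿ fromℚ (_/_ (+ (2 * r ∸ 5)) (2 * r ∸ 3) {{2r∸3-nonZero 3≤r}}) →
    δχ H ≤ᴿ δVC H
corollary1p10 H (suc (suc (suc k))) (s≤s (s≤s (s≤s z≤n))) χ (inj₁ (δχ≤ , _)) up = δχ≤ (δVC-above H k χ up)
corollary1p10 H r@(suc (suc (suc k))) 3≤r@(s≤s (s≤s (s≤s z≤n))) χ (inj₂ δχ≈@(δχ≤ , _)) up =
  δχ≤ (δχ≈⇒δVC-above H k (_/_ (+ (2 * r ∸ 5)) (2 * r ∸ 3) {{2r∸3-nonZero 3≤r}})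
    (/-mono-< k (suc k) (2 * r ∸ 5) (2 * r ∸ 3) {{_}} {{2r∸3-nonZero 3≤r}} lower)
    (/-mono-< (2 * r ∸ 5) (2 * r ∸ 3) (suc k) (suc (suc k)) {{2r∸3-nonZero 3≤r}} upper) δχ≈ up)
  where
  numerator : 2 * r ∸ 5 ≡ suc (2 * k)
  numerator = trans (cong (_∸ 5) (shape k)) (m+n∸m≡n 5 (suc (2 * k)))
    where
    shape : ∀ k → 2 * (3 + k) ≡ 5 + suc (2 * k)
    shape = solve-∀
  denominator : 2 * r ∸ 3 ≡ 3 + 2 * k
  denominator = trans (cong (_∸ 3) (shape k)) (m+n∸m≡n 3 (3 + 2 * k))
    where
    shape : ∀ k → 2 * (3 + k) ≡ 3 + (3 + 2 * k)
    shape = solve-∀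
  -- The middle fraction is the mediant of `k/(k+1)` and `(k+1)/(k+2)`, so in both comparisons the
  -- cross products differ by exactly one.
  lower : k * (2 * r ∸ 3) < (2 * r ∸ 5) * suc k
  lower = subst₂ (λ a b → k * b < a * suc k) (sym numerator) (sym denominator) (≤-reflexive (shape k))
    where
    shape : ∀ k → suc (k * (3 + 2 * k)) ≡ suc (2 * k) * suc k
    shape = solve-∀
  upper : (2 * r ∸ 5) * suc (suc k) < suc k * (2 * r ∸ 3)
  upper = subst₂ (λ a b → a * suc (suc k) < suc k * b) (sym numerator) (sym denominator) (≤-reflexive (shape k))
    where
    shape : ∀ k → suc (suc (2 * k) * suc (suc k)) ≡ suc k * (3 + 2 * k)
    shape = solve-∀
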